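{- Let $Cay(H,S)$ be a Cayley digraph of order $n$. Let $\{\chi_i\}_{i=1,2,\dots,n}$ be the set of all distinct characters on $H$ such that $\chi_1$ is the trivial one. Define $$n_*=\frac{n}{|S|}\left(\max_{2\leq i\leq n}\Big|\sum_{s\in S}\chi_i(s)\Big|\right)$$ and let $X,Y$ be subsets of vertices of $Cay(H,S)$. If $\sqrt{|X||Y|}>n_*$, then there exists a directed edge between a vertex in $X$ and a vertex in $Y$. In particular, if $|X|>n_*$, then there exist at least two distinct vertices of $X$ with a directed edge between them.
   Context: Let $H$ be a finite abelian group and $S$ a subset of $H$. The Cayley digraph $Cay(H,S)$ is the digraph with vertex set $H$ in which there is a directed edge $u\to v$ if and only if $v-u\in S$; its order is the number of its vertices, $n=|H|$. A character of $H$ is a group homomorphism $\chi:H\to\mathbb{C}^{*}$ into the multiplicative group of nonzero complex numbers; the trivial character is the one with $\chi(h)=1$ for every $h\in H$. The bars around the character sum denote the complex absolute value.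
   Formalization: The "in particular" clause is proved under the added assumption 0 ∉ S (no loops); without it the clause is false, e.g. H = Z/2, S = H, X = {0}, where n_* = 0 < |X| = 1 but X has no two distinct vertices. -}

module Defs where

open import Algebra.Bundles using (AbelianGroup)
open import Algebra.Bundles.Raw using (RawMagma; RawMonoid)
import Algebra.Definitions.RawMonoid as RawMonoidDefinitions
open import Algebra.Morphism.Structures using (IsMagmaHomomorphism)
open import Data.Bool.Base using (if_then_else_)
open import Data.Fin.Base using (Fin; zero; suc)
open import Data.Fin.Subset as Subset using (Subset)
open import Data.Integer.Base as ℤ using (+_; -[1+_])
import Data.Integer.Properties as ℤ
open import Data.Nat.Base as ℕ using (ℕ; zero; suc)
open import Data.Nat.Coprimality as Coprimality using (1-coprimeTo)
import Data.Nat.Properties as ℕ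
open import Data.Product.Base using (∃-syntax; _×_; _,_; proj₁; proj₂)
open import Data.Rational.Base as ℚ using (ℚ; mkℚ; *≤*; 0ℚ; 1ℚ; ½)
import Data.Rational.Properties as ℚ
open import Data.Rational.Solver using (module +-*-Solver)
open import Data.Sum.Base using (inj₁; inj₂)
open import Data.Vec.Base using (lookup)
import Data.Vec.Functional as Vector
open import Function.Bundles using (Inverse)
open import Level using (_⊔_; 0ℓ)
open import Relation.Binary.Core using (Rel)
open import Relation.Binary.PropositionalEquality
  using (_≡_; refl; sym; trans; cong; subst; subst₂; setoid)
open import Relation.Nullary using (¬_; yes; no; contradiction)

module RationalLemmas where
  open import Data.Rational.Base hiding (_⊔_)
  open +-*-Solver

  ½+½ : ∀ ε → ε * ½ + ε * ½ ≡ ε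
  ½+½ = solve 1 (λ e → e :* con ½ :+ e :* con ½ := e) refl

  0<½* : ∀ {ε} → 0ℚ < ε → 0ℚ < ε * ½
  0<½* {ε} 0<ε = subst (_< ε * ½) (ℚ.*-zeroˡ ½) (ℚ.*-monoˡ-<-pos ½ 0<ε)

  0<* : ∀ {p q} → 0ℚ < p → 0ℚ < q → 0ℚ < p * q
  0<* {p} {q} 0<p 0<q =
    subst (_< p * q) (ℚ.*-zeroˡ q) (ℚ.*-monoˡ-<-pos q {{positive 0<q}} 0<p)

  0≤* : ∀ {p q} → 0ℚ ≤ p → 0ℚ ≤ q → 0ℚ ≤ p * q
  0≤* {p} {q} 0≤p 0≤q =
    subst (_≤ p * q) (ℚ.*-zeroˡ q) (ℚ.*-monoʳ-≤-nonNeg q {{nonNegative 0≤q}} 0≤p)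

  *-mono-≤ : ∀ {p q r s} → 0ℚ ≤ p → 0ℚ ≤ s → p ≤ q → r ≤ s → p * r ≤ q * s
  *-mono-≤ {p} {q} {r} {s} 0≤p 0≤s p≤q r≤s = ℚ.≤-trans
    (ℚ.*-monoˡ-≤-nonNeg p {{nonNegative 0≤p}} r≤s)
    (ℚ.*-monoʳ-≤-nonNeg s {{nonNegative 0≤s}} p≤q)

  ≤+ : ∀ {p q} → 0ℚ ≤ q → p ≤ p + q
  ≤+ {p} {q} 0≤q = subst (_≤ p + q) (ℚ.+-identityʳ p) (ℚ.+-monoʳ-≤ p 0≤q)

  <+ : ∀ {p q} → 0ℚ < q → p < p + q
  <+ {p} {q} 0<q = subst (_< p + q) (ℚ.+-identityʳ p) (ℚ.+-monoʳ-< p 0<q)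

  p≤∣p∣ : ∀ p → p ≤ ∣ p ∣
  p≤∣p∣ p with ℚ.≤-total 0ℚ p
  ... | inj₁ 0≤p = ℚ.≤-reflexive (sym (ℚ.0≤p⇒∣p∣≡p 0≤p))
  ... | inj₂ p≤0 = ℚ.≤-trans p≤0 (ℚ.0≤∣p∣ p)

  near⇒< : ∀ {p q ε} → ∣ p - q ∣ < ε → p < q + ε
  near⇒< {p} {q} {ε} h = subst (_< q + ε)
    (solve 2 (λ x y → y :+ (x :- y) := x) refl p q)
    (ℚ.+-monoʳ-< q (ℚ.≤-<-trans (p≤∣p∣ (p - q)) h))

  near-sym : ∀ {p q ε} → ∣ p - q ∣ < ε → ∣ q - p ∣ < ε
  near-sym {p} {q} {ε} = subst (_< ε) (trans (sym (ℚ.∣-p∣≡∣p∣ (p - q)))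
    (cong ∣_∣ (solve 2 (λ x y → :- (x :- y) := y :- x) refl p q)))

  <⇒near : ∀ {p q ε} → p < q + ε → q < p + ε → ∣ p - q ∣ < ε
  <⇒near {p} {q} {ε} p<q+ε q<p+ε with ℚ.∣p∣≡p∨∣p∣≡-p (p - q)
  ... | inj₁ eq = subst₂ _<_
    (trans (solve 2 (λ x y → :- y :+ x := x :- y) refl p q) (sym eq))
    (solve 2 (λ y e → :- y :+ (y :+ e) := e) refl q ε)
    (ℚ.+-monoʳ-< (- q) p<q+ε)
  ... | inj₂ eq = subst₂ _<_
    (trans (solve 2 (λ x y → :- x :+ y := :- (x :- y)) refl p q) (sym eq))
    (solve 2 (λ x e → :- x :+ (x :+ e) := e) refl p ε)
    (ℚ.+-monoʳ-< (- p) q<p+ε)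

  +-near : ∀ {p p′ q q′ ε δ} → ∣ p - p′ ∣ < ε → ∣ q - q′ ∣ < δ →
           ∣ (p + q) - (p′ + q′) ∣ < ε + δ
  +-near {p} {p′} {q} {q′} hp hq = ℚ.≤-<-trans
    (subst (λ z → ∣ z ∣ ≤ ∣ p - p′ ∣ + ∣ q - q′ ∣)
      (solve 4 (λ x x′ y y′ → (x :- x′) :+ (y :- y′) := (x :+ y) :- (x′ :+ y′))
        refl p p′ q q′)
      (ℚ.∣p+q∣≤∣p∣+∣q∣ (p - p′) (q - q′)))
    (ℚ.+-mono-< hp hq)

  neg-near : ∀ {p p′ ε} → ∣ p - p′ ∣ < ε → ∣ (- p) - (- p′) ∣ < ε
  neg-near {p} {p′} {ε} = subst (_< ε) (trans (sym (ℚ.∣-p∣≡∣p∣ (p - p′)))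
    (cong ∣_∣ (solve 2 (λ x y → :- (x :- y) := (:- x) :- (:- y)) refl p p′)))

  *-near : ∀ {p p′ q q′ B C ε δ} → ∣ p ∣ < B → ∣ q′ ∣ < C →
           ∣ p - p′ ∣ < ε → ∣ q - q′ ∣ < δ →
           ∣ (p * q) - (p′ * q′) ∣ ≤ B * δ + ε * C
  *-near {p} {p′} {q} {q′} {B} {C} {ε} {δ} p<B q′<C hp hq = ℚ.≤-trans
    (subst (λ z → ∣ z ∣ ≤ ∣ p * (q - q′) ∣ + ∣ (p - p′) * q′ ∣)
      (solve 4 (λ x x′ y y′ → x :* (y :- y′) :+ (x :- x′) :* y′ := x :* y :- x′ :* y′)
        refl p p′ q q′)
      (ℚ.∣p+q∣≤∣p∣+∣q∣ (p * (q - q′)) ((p - p′) * q′)))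
    (ℚ.+-mono-≤
      (product p (q - q′) p<B hq)
      (product (p - p′) q′ hp q′<C))
    where
    product : ∀ a b {α β} → ∣ a ∣ < α → ∣ b ∣ < β → ∣ a * b ∣ ≤ α * β
    product a b {α} {β} a<α b<β = subst (_≤ α * β) (sym (ℚ.∣p*q∣≡∣p∣*∣q∣ a b))
      (*-mono-≤ (ℚ.0≤∣p∣ a) (ℚ.<⇒≤ (ℚ.≤-<-trans (ℚ.0≤∣p∣ b) b<β))
        (ℚ.<⇒≤ a<α) (ℚ.<⇒≤ b<β))

  ⊔-< : ∀ {p q r} → p < r → q < r → p ℚ.⊔ q < r
  ⊔-< {p} {q} {r} p<r q<r with ℚ.≤-total p q
  ... | inj₁ p≤q = subst (_< r) (sym (ℚ.p≤q⇒p⊔q≡q p≤q)) q<r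
  ... | inj₂ q≤p = subst (_< r) (sym (ℚ.p≥q⇒p⊔q≡p q≤p)) p<r

  ⊔-near : ∀ {p p′ q q′ ε} → ∣ p - p′ ∣ < ε → ∣ q - q′ ∣ < ε →
           ∣ (p ℚ.⊔ q) - (p′ ℚ.⊔ q′) ∣ < ε
  ⊔-near {p} {p′} {q} {q′} {ε} hp hq = <⇒near {p ℚ.⊔ q} {p′ ℚ.⊔ q′} {ε}
    (oneSided p p′ q q′ hp hq)
    (oneSided p′ p q′ q (near-sym {p} {p′} hp) (near-sym {q} {q′} hq))
    where
    oneSided : ∀ a a′ b b′ → ∣ a - a′ ∣ < ε → ∣ b - b′ ∣ < ε →
               a ℚ.⊔ b < (a′ ℚ.⊔ b′) + ε
    oneSided a a′ b b′ ha hb = ⊔-<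
      (ℚ.<-≤-trans (near⇒< {a} {a′} ha) (ℚ.+-monoˡ-≤ ε (ℚ.p≤p⊔q a′ b′)))
      (ℚ.<-≤-trans (near⇒< {b} {b′} hb) (ℚ.+-monoˡ-≤ ε (ℚ.p≤q⊔p a′ b′)))

  *-modulus : ∀ {B C ε} → 0ℚ < B → 0ℚ < C → 0ℚ < ε →
              ∃[ δ ] 0ℚ < δ × B * δ + δ * C < ε
  *-modulus {B} {C} {ε} 0<B 0<C 0<ε = η * 1/ D
    , 0<* (0<½* 0<ε) (ℚ.positive⁻¹ (1/ D) {{ℚ.1/pos⇒pos D {{positive 0<D}}}})
    , subst₂ _<_ (sym eq) (½+½ ε) (<+ (0<½* 0<ε))
    where
    η D : ℚ
    η = ε * ½
    D = B + C
    0<D : 0ℚ < D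
    0<D = ℚ.+-mono-< 0<B 0<C
    instance
      D≢0 : NonZero D
      D≢0 = ℚ.pos⇒nonZero D {{positive 0<D}}
    eq : B * (η * 1/ D) + (η * 1/ D) * C ≡ η
    eq = trans
      (solve 4 (λ b c e i → b :* (e :* i) :+ (e :* i) :* c := e :* (i :* (b :+ c)))
        refl B C η (1/ D))
      (trans (cong (η *_) (ℚ.*-inverseˡ D)) (ℚ.*-identityʳ η))

  ½^ : ℕ → ℚ
  ½^ zero    = 1ℚ
  ½^ (suc k) = ½ * ½^ k

  0<½^ : ∀ k → 0ℚ < ½^ k
  0<½^ zero    = ℚ.positive⁻¹ 1ℚ
  0<½^ (suc k) = 0<* (ℚ.positive⁻¹ ½) (0<½^ k)

  ½^-suc-≤ : ∀ k → ½^ (suc k) ≤ ½^ k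
  ½^-suc-≤ k = subst (½^ (suc k) ≤_)
    (solve 1 (λ h → con ½ :* h :+ con ½ :* h := h) refl (½^ k))
    (≤+ (ℚ.<⇒≤ (0<½^ (suc k))))

  ½^-antitone : ∀ {m n} → m ℕ.≤′ n → ½^ n ≤ ½^ m
  ½^-antitone ℕ.≤′-refl           = ℚ.≤-refl
  ½^-antitone {n = suc n} (ℕ.≤′-step m≤n) =
    ℚ.≤-trans (½^-suc-≤ n) (½^-antitone m≤n)

  ι : ℕ → ℚ
  ι n = mkℚ (+ n) 0 (Coprimality.sym (1-coprimeTo n))

  ι-suc : ∀ n → ι (suc n) ≡ 1ℚ + ι n
  ι-suc n = trans (sym (ℚ.↥p/↧p≡p (ι (suc n))))
    (cong (_/ 1) (cong (λ z → + 1 ℤ.+ z) (sym (ℤ.*-identityʳ (+ n)))))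

  ≤ι : ∀ p → p ≤ ι ℤ.∣ ↥ p ∣
  ≤ι p@(mkℚ (+ n) d _) = *≤* (ℤ.*-monoˡ-≤-nonNeg (+ n) (ℤ.+≤+ (ℕ.s≤s ℕ.z≤n)))
  ≤ι p@(mkℚ -[1+ n ] d _) = *≤* ℤ.-≤+

  ½^*ι<1 : ∀ n → ½^ n * ι n < 1ℚ
  ½^*ι<1 zero    = ℚ.positive⁻¹ 1ℚ
  ½^*ι<1 (suc n) = subst₂ _<_
    (trans (solve 2 (λ h i → con ½ :* (h :+ h :* i) := (con ½ :* h) :* (con 1ℚ :+ i))
             refl (½^ n) (ι n))
           (cong (½^ (suc n) *_) (sym (ι-suc n))))
    refl
    (ℚ.*-monoʳ-<-pos ½ (ℚ.+-mono-≤-< (½^-antitone (ℕ.≤⇒≤′ (ℕ.z≤n {n}))) (½^*ι<1 n)))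

  ½^-small : ∀ C {δ} → 0ℚ ≤ C → 0ℚ < δ → ∃[ N ] (∀ k → N ℕ.≤ k → C * ½^ k < δ)
  ½^-small C {δ} 0≤C 0<δ = N , λ k N≤k → ℚ.≤-<-trans
    (ℚ.*-monoˡ-≤-nonNeg C {{nonNegative 0≤C}} (½^-antitone (ℕ.≤⇒≤′ N≤k)))
    (ℚ.≤-<-trans C*½^N≤ (subst (δ * (½^ N * ι N) <_) (ℚ.*-identityʳ δ)
      (ℚ.*-monoʳ-<-pos δ {{positive 0<δ}} (½^*ι<1 N))))
    where
    instance
      δ≢0 : NonZero δ
      δ≢0 = >-nonZero 0<δ
    N : ℕ
    N = ℤ.∣ ↥ (C ÷ δ) ∣
    C≡ : (C ÷ δ) * δ ≡ C
    C≡ = trans (ℚ.*-assoc C (1/ δ) δ)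
      (trans (cong (C *_) (ℚ.*-inverseˡ δ)) (ℚ.*-identityʳ C))
    C≤ : C ≤ ι N * δ
    C≤ = subst (_≤ ι N * δ) C≡
      (ℚ.*-monoʳ-≤-nonNeg δ {{nonNegative (ℚ.<⇒≤ 0<δ)}} (≤ι (C ÷ δ)))
    C*½^N≤ : C * ½^ N ≤ δ * (½^ N * ι N)
    C*½^N≤ = subst (C * ½^ N ≤_)
      (solve 3 (λ i d h → (i :* d) :* h := d :* (h :* i)) refl (ι N) δ (½^ N))
      (ℚ.*-monoʳ-≤-nonNeg (½^ N) {{nonNegative (ℚ.<⇒≤ (0<½^ N))}} C≤)

module RationalSqrt where
  open import Data.Rational.Base hiding (_⊔_)
  open RationalLemmas
  open +-*-Solver

  -- Bisection: keeps l² ≤ q < (l + w)² while halving w.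
  bisect : ℚ → ℕ → ℚ → ℚ → ℚ
  bisect q zero    l w = l
  bisect q (suc k) l w with (l + ½ * w) * (l + ½ * w) ℚ.≤? q
  ... | yes _ = bisect q k (l + ½ * w) (½ * w)
  ... | no  _ = bisect q k l (½ * w)

  √ℚ : ℚ → ℕ → ℚ
  √ℚ q k = bisect q k 0ℚ (q + 1ℚ)

  record Bracket (q l w : ℚ) : Set where
    field
      0≤l : 0ℚ ≤ l
      0<w : 0ℚ < w
      l²≤ : l * l ≤ q
      <u² : q < (l + w) * (l + w)

  bisect-bracket : ∀ {q} k {l w} → Bracket q l w →
                   Bracket q (bisect q k l w) (w * ½^ k)
  bisect-bracket {q} zero {l} {w} b =
    subst (Bracket q l) (sym (ℚ.*-identityʳ w)) b
  bisect-bracket {q} (suc k) {l} {w} b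
    with (l + ½ * w) * (l + ½ * w) ℚ.≤? q
  ... | yes m²≤q = subst (Bracket q _)
      (solve 2 (λ x h → (con ½ :* x) :* h := x :* (con ½ :* h)) refl w (½^ k))
      (bisect-bracket k record
        { 0≤l = ℚ.≤-trans (Bracket.0≤l b) (≤+ (ℚ.<⇒≤ 0<½w))
        ; 0<w = 0<½w
        ; l²≤ = m²≤q
        ; <u² = subst (q <_)
            (solve 2 (λ x y → (x :+ y) :* (x :+ y) :=
                (x :+ con ½ :* y :+ con ½ :* y) :* (x :+ con ½ :* y :+ con ½ :* y))
              refl l w)
            (Bracket.<u² b)
        })
    where
    0<½w : 0ℚ < ½ * w
    0<½w = 0<* (ℚ.positive⁻¹ ½) (Bracket.0<w b)
  ... | no m²≰q = subst (Bracket q _)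
      (solve 2 (λ x h → (con ½ :* x) :* h := x :* (con ½ :* h)) refl w (½^ k))
      (bisect-bracket k record
        { 0≤l = Bracket.0≤l b
        ; 0<w = 0<* (ℚ.positive⁻¹ ½) (Bracket.0<w b)
        ; l²≤ = Bracket.l²≤ b
        ; <u² = ℚ.≰⇒> m²≰q
        })

  √ℚ-bracket : ∀ {q} → 0ℚ ≤ q → ∀ k → Bracket q (√ℚ q k) ((q + 1ℚ) * ½^ k)
  √ℚ-bracket {q} 0≤q k = bisect-bracket k record
    { 0≤l = ℚ.≤-refl
    ; 0<w = 0<q+1
    ; l²≤ = 0≤q
    ; <u² = subst (q <_)
        (solve 1 (λ x → x :+ (x :* x :+ x :+ con 1ℚ) :=
            (con 0ℚ :+ (x :+ con 1ℚ)) :* (con 0ℚ :+ (x :+ con 1ℚ))) refl q)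
        (<+ (ℚ.+-mono-≤-< (ℚ.+-mono-≤ (0≤* 0≤q 0≤q) 0≤q) (ℚ.positive⁻¹ 1ℚ)))
    }
    where
    0<q+1 : 0ℚ < q + 1ℚ
    0<q+1 = ℚ.+-mono-≤-< 0≤q (ℚ.positive⁻¹ 1ℚ)

  Bracket-< : ∀ {p q l l′ w w′ δ} → Bracket p l w → Bracket q l′ w′ →
              0ℚ < δ → ∣ p - q ∣ < δ * δ → w′ < δ → l < l′ + (δ + δ)
  Bracket-< {p} {q} {l} {l′} {w} {w′} {δ} b b′ 0<δ p~q w′<δ
    with l ℚ.<? l′ + (δ + δ)
  ... | yes l<  = l<
  ... | no  l≮ = contradiction (ℚ.<-≤-trans p<u² (ℚ.≤-trans u²≤l² (Bracket.l²≤ b)))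
                   (ℚ.<-irrefl refl)
    where
    u : ℚ
    u = l′ + w′
    0≤u : 0ℚ ≤ u
    0≤u = ℚ.+-mono-≤ (Bracket.0≤l b′) (ℚ.<⇒≤ (Bracket.0<w b′))
    0≤u+δ : 0ℚ ≤ u + δ
    0≤u+δ = ℚ.+-mono-≤ 0≤u (ℚ.<⇒≤ 0<δ)
    u+δ≤l : u + δ ≤ l
    u+δ≤l = ℚ.≤-trans
      (subst (_≤ l′ + (δ + δ)) (sym (ℚ.+-assoc l′ w′ δ))
        (ℚ.+-monoʳ-≤ l′ (ℚ.+-monoˡ-≤ δ (ℚ.<⇒≤ w′<δ))))
      (ℚ.≮⇒≥ l≮)
    u²≤l² : (u + δ) * (u + δ) ≤ l * l
    u²≤l² = *-mono-≤ 0≤u+δ (ℚ.≤-trans 0≤u+δ u+δ≤l) u+δ≤l u+δ≤l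
    p<u² : p < (u + δ) * (u + δ)
    p<u² = ℚ.<-≤-trans (near⇒< {p} {q} p~q) (ℚ.≤-trans
      (ℚ.+-monoˡ-≤ (δ * δ) (ℚ.<⇒≤ (Bracket.<u² b′)))
      (subst (u * u + δ * δ ≤_)
        (solve 2 (λ x d → (x :* x :+ d :* d) :+ (x :* d :+ x :* d) :=
            (x :+ d) :* (x :+ d)) refl u δ)
        (≤+ (ℚ.+-mono-≤ (0≤* 0≤u (ℚ.<⇒≤ 0<δ)) (0≤* 0≤u (ℚ.<⇒≤ 0<δ))))))

-- The real numbers, as Cauchy sequences of rationals up to _≈ᴿ_.

IsCauchy : (ℕ → ℚ) → Set
IsCauchy x = ∀ ε → 0ℚ ℚ.< ε →
  ∃[ N ] (∀ m n → N ℕ.≤ m → N ℕ.≤ n → ℚ.∣ x m ℚ.- x n ∣ ℚ.< ε)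

record ℝ : Set where
  constructor mkℝ
  field
    seq    : ℕ → ℚ
    cauchy : IsCauchy seq

open ℝ public

infix 4 _≈ᴿ_ _<ᴿ_

_≈ᴿ_ : Rel ℝ 0ℓ
x ≈ᴿ y = ∀ ε → 0ℚ ℚ.< ε →
  ∃[ N ] (∀ n → N ℕ.≤ n → ℚ.∣ seq x n ℚ.- seq y n ∣ ℚ.< ε)

-- The terms must stay apart by a fixed ε: x n < y n for all n only gives x ≤ y.
_<ᴿ_ : Rel ℝ 0ℓ
x <ᴿ y = ∃[ ε ] 0ℚ ℚ.< ε × ∃[ N ] (∀ n → N ℕ.≤ n → seq x n ℚ.+ ε ℚ.< seq y n)

module CauchyLemmas where
  open import Data.Rational.Base hiding (_⊔_)
  open RationalLemmas
  open RationalSqrt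
  open +-*-Solver

  both : ∀ {P Q : ℕ → ℕ → Set} →
         ∃[ M ] (∀ m n → M ℕ.≤ m → M ℕ.≤ n → P m n) →
         ∃[ N ] (∀ m n → N ℕ.≤ m → N ℕ.≤ n → Q m n) →
         ∃[ K ] (∀ m n → K ℕ.≤ m → K ℕ.≤ n → P m n × Q m n)
  both (M , p) (N , q) = M ℕ.⊔ N , λ m n ≤m ≤n →
    p m n (ℕ.m⊔n≤o⇒m≤o M N ≤m) (ℕ.m⊔n≤o⇒m≤o M N ≤n) ,
    q m n (ℕ.m⊔n≤o⇒n≤o M N ≤m) (ℕ.m⊔n≤o⇒n≤o M N ≤n)

  mapEventually : ∀ {P Q : ℕ → ℕ → Set} → (∀ m n → P m n → Q m n) →
        ∃[ N ] (∀ m n → N ℕ.≤ m → N ℕ.≤ n → P m n) →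
        ∃[ N ] (∀ m n → N ℕ.≤ m → N ℕ.≤ n → Q m n)
  mapEventually f (N , p) = N , λ m n ≤m ≤n → f m n (p m n ≤m ≤n)

  +-cauchy : ∀ x y → IsCauchy (λ n → seq x n + seq y n)
  +-cauchy x y ε 0<ε = mapEventually
    (λ m n (hx , hy) →
      subst (∣ (seq x m + seq y m) - (seq x n + seq y n) ∣ <_) (½+½ ε)
        (+-near {seq x m} {seq x n} {seq y m} {seq y n} {ε * ½} {ε * ½} hx hy))
    (both (cauchy x (ε * ½) (0<½* 0<ε)) (cauchy y (ε * ½) (0<½* 0<ε)))

  neg-cauchy : ∀ x → IsCauchy (λ n → - seq x n)
  neg-cauchy x ε 0<ε = mapEventually
    (λ m n → neg-near {seq x m} {seq x n} {ε})
    (cauchy x ε 0<ε)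

  ⊔-cauchy : ∀ x y → IsCauchy (λ n → seq x n ℚ.⊔ seq y n)
  ⊔-cauchy x y ε 0<ε = mapEventually
    (λ m n (hx , hy) → ⊔-near {seq x m} {seq x n} {seq y m} {seq y n} {ε} hx hy)
    (both (cauchy x ε 0<ε) (cauchy y ε 0<ε))

  bounded : ∀ x → ∃[ B ] 0ℚ < B × ∃[ N ] (∀ m n → N ℕ.≤ m → N ℕ.≤ n →
                                          ∣ seq x m ∣ < B × ∣ seq x n ∣ < B)
  bounded x = bound (cauchy x 1ℚ (ℚ.positive⁻¹ 1ℚ))
    where
    bound : ∃[ N ] (∀ m n → N ℕ.≤ m → N ℕ.≤ n → ∣ seq x m - seq x n ∣ < 1ℚ) → _
    bound (N , hx) = ∣ seq x N ∣ + 1ℚ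
      , ℚ.+-mono-≤-< (ℚ.0≤∣p∣ (seq x N)) (ℚ.positive⁻¹ 1ℚ)
      , N , λ m n ≤m ≤n → below m ≤m , below n ≤n
      where
      below : ∀ n → N ℕ.≤ n → ∣ seq x n ∣ < ∣ seq x N ∣ + 1ℚ
      below n ≤n = ℚ.≤-<-trans
        (subst (λ z → ∣ z ∣ ≤ ∣ seq x N ∣ + ∣ seq x n - seq x N ∣)
          (solve 2 (λ a b → a :+ (b :- a) := b) refl (seq x N) (seq x n))
          (ℚ.∣p+q∣≤∣p∣+∣q∣ (seq x N) (seq x n - seq x N)))
        (ℚ.+-monoʳ-< ∣ seq x N ∣ (hx n N ≤n ℕ.≤-refl))

  *-cauchy : ∀ x y → IsCauchy (λ n → seq x n * seq y n)
  *-cauchy x y ε 0<ε =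
    let B , 0<B , x<B = bounded x
        C , 0<C , y<C = bounded y
        δ , 0<δ , small = *-modulus {B} {C} {ε} 0<B 0<C 0<ε
    in mapEventually
      (λ m n ((xB , yC) , (hx , hy)) → ℚ.≤-<-trans
        (*-near {seq x m} {seq x n} {seq y m} {seq y n} {B} {C} {δ} {δ}
          (proj₁ xB) (proj₂ yC) hx hy)
        small)
      (both (both x<B y<C) (both (cauchy x δ 0<δ) (cauchy y δ 0<δ)))

  √-cauchy : ∀ x → IsCauchy (λ n → √ℚ (seq x n ℚ.⊔ 0ℚ) n)
  √-cauchy x ε 0<ε =
    let B , 0<B , x<B = bounded x
        N , small = ½^-small (B + 1ℚ) (ℚ.<⇒≤ (ℚ.+-mono-< 0<B (ℚ.positive⁻¹ 1ℚ))) 0<δ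
    in mapEventually
      (λ m n ((xm<B , xn<B) , (sm , sn) , hx) →
        <⇒near {√ℚ (x⁺ m) m} {√ℚ (x⁺ n) n} {ε}
          (oneSided m n (near m n hx) (width B n 0<B xn<B sn))
          (oneSided n m (near-sym {x⁺ m} {x⁺ n} (near m n hx)) (width B m 0<B xm<B sm)))
      (both x<B (both (N , λ m n ≤m ≤n → small m ≤m , small n ≤n)
                      (cauchy x (δ * δ) (0<* 0<δ 0<δ))))
    where
    δ : ℚ
    δ = ε * ½
    0<δ : 0ℚ < δ
    0<δ = 0<½* 0<ε
    x⁺ : ℕ → ℚ
    x⁺ n = seq x n ℚ.⊔ 0ℚ
    0≤x⁺ : ∀ n → 0ℚ ≤ x⁺ n
    0≤x⁺ n = ℚ.p≤q⊔p (seq x n) 0ℚ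
    width : ∀ B n → 0ℚ < B → ∣ seq x n ∣ < B → (B + 1ℚ) * ½^ n < δ →
            (x⁺ n + 1ℚ) * ½^ n < δ
    width B n 0<B xn<B = ℚ.≤-<-trans
      (ℚ.*-monoʳ-≤-nonNeg (½^ n) {{nonNegative (ℚ.<⇒≤ (0<½^ n))}}
        (ℚ.+-monoˡ-≤ 1ℚ (ℚ.<⇒≤ (⊔-< (ℚ.≤-<-trans (p≤∣p∣ (seq x n)) xn<B) 0<B))))
    near : ∀ m n → ∣ seq x m - seq x n ∣ < δ * δ → ∣ x⁺ m - x⁺ n ∣ < δ * δ
    near m n hx = ⊔-near {seq x m} {seq x n} {0ℚ} {0ℚ} {δ * δ} hx (0<* 0<δ 0<δ)
    oneSided : ∀ m n → ∣ x⁺ m - x⁺ n ∣ < δ * δ → (x⁺ n + 1ℚ) * ½^ n < δ →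
               √ℚ (x⁺ m) m < √ℚ (x⁺ n) n + ε
    oneSided m n h wn = subst (λ z → √ℚ (x⁺ m) m < √ℚ (x⁺ n) n + z) (½+½ ε)
      (Bracket-< (√ℚ-bracket (0≤x⁺ m) m) (√ℚ-bracket (0≤x⁺ n) n) 0<δ h wn)

open CauchyLemmas

infixl 6 _+ᴿ_ _⊔ᴿ_
infixl 7 _*ᴿ_
infix  8 -ᴿ_ √_

_+ᴿ_ : ℝ → ℝ → ℝ
x +ᴿ y = mkℝ (λ n → seq x n ℚ.+ seq y n) (+-cauchy x y)

-ᴿ_ : ℝ → ℝ
-ᴿ x = mkℝ (λ n → ℚ.- seq x n) (neg-cauchy x)

_*ᴿ_ : ℝ → ℝ → ℝ
x *ᴿ y = mkℝ (λ n → seq x n ℚ.* seq y n) (*-cauchy x y)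

_⊔ᴿ_ : ℝ → ℝ → ℝ
x ⊔ᴿ y = mkℝ (λ n → seq x n ℚ.⊔ seq y n) (⊔-cauchy x y)

fromℚ : ℚ → ℝ
fromℚ q = mkℝ (λ _ → q) (λ ε 0<ε → 0 , λ _ _ _ _ →
  subst (ℚ._< ε) (sym (cong ℚ.∣_∣ (ℚ.+-inverseʳ q))) 0<ε)

fromℕ : ℕ → ℝ
fromℕ n = fromℚ (+ n ℚ./ 1)

-- √ x is the square root of max(x, 0), to be used for x ≥ 0.  Its n-th term is
-- the n-th bisection approximation to the square root of the n-th term of x.
√_ : ℝ → ℝ
√ x = mkℝ (λ n → RationalSqrt.√ℚ (seq x n ℚ.⊔ 0ℚ) n) (√-cauchy x)

record ℂ : Set where
  constructor _+i_
  field
    re im : ℝ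

open ℂ public

infix  4 _≈ᶜ_
infixl 6 _+ᶜ_
infixl 7 _*ᶜ_

_≈ᶜ_ : Rel ℂ 0ℓ
z ≈ᶜ w = re z ≈ᴿ re w × im z ≈ᴿ im w

0ᶜ 1ᶜ : ℂ
0ᶜ = fromℕ 0 +i fromℕ 0
1ᶜ = fromℕ 1 +i fromℕ 0

_+ᶜ_ : ℂ → ℂ → ℂ
z +ᶜ w = (re z +ᴿ re w) +i (im z +ᴿ im w)

_*ᶜ_ : ℂ → ℂ → ℂ
z *ᶜ w = (re z *ᴿ re w +ᴿ -ᴿ (im z *ᴿ im w)) +i (re z *ᴿ im w +ᴿ im z *ᴿ re w)

∣_∣ᶜ : ℂ → ℝ
∣ z ∣ᶜ = √ (re z *ᴿ re z +ᴿ im z *ᴿ im z)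

+ᶜ-rawMonoid : RawMonoid 0ℓ 0ℓ
+ᶜ-rawMonoid = record { _≈_ = _≈ᶜ_ ; _∙_ = _+ᶜ_ ; ε = 0ᶜ }

*ᶜ-rawMagma : RawMagma 0ℓ 0ℓ
*ᶜ-rawMagma = record { _≈_ = _≈ᶜ_ ; _∙_ = _*ᶜ_ }

open RawMonoidDefinitions +ᶜ-rawMonoid using () renaming (sum to sumᶜ)

-- A group homomorphism H → ℂ* is a map into the nonzero complex numbers that
-- preserves products; preservation of units and inverses follows.
record Character {c ℓ} (H : AbelianGroup c ℓ) : Set (c ⊔ ℓ) where
  open AbelianGroup H using (Carrier; rawMagma)
  field
    ⟦_⟧                 : Carrier → ℂ
    nonzero             : ∀ h → ¬ (⟦ h ⟧ ≈ᶜ 0ᶜ)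
    isMagmaHomomorphism : IsMagmaHomomorphism rawMagma *ᶜ-rawMagma ⟦_⟧

module _ {c ℓ} {H : AbelianGroup c ℓ} where
  open AbelianGroup H using (Carrier)

  infix 4 _≈ˣ_

  _≈ˣ_ : Rel (Character H) c
  χ ≈ˣ ψ = ∀ h → Character.⟦_⟧ χ h ≈ᶜ Character.⟦_⟧ ψ h

  IsTrivial : Character H → Set c
  IsTrivial χ = ∀ h → Character.⟦_⟧ χ h ≈ᶜ 1ᶜ

HasOrder : ∀ {c ℓ} → AbelianGroup c ℓ → ℕ → Set (c ⊔ ℓ)
HasOrder H n = Inverse (AbelianGroup.setoid H) (setoid (Fin n))

-- A subset of H is given by the set of indices of its elements under the
-- bijection with Fin n; its cardinality is then that of the index set.
module Cayley {c ℓ} (H : AbelianGroup c ℓ) {n : ℕ} (order : HasOrder H n) where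
  open AbelianGroup H using (Carrier; _-_)
  open Inverse order using (to; from)

  infix 4 _∈_ _∉_

  _∈_ : Carrier → Subset n → Set
  h ∈ A = to h Subset.∈ A

  _∉_ : Carrier → Subset n → Set
  h ∉ A = ¬ (h ∈ A)

  Cay : Subset n → Rel Carrier 0ℓ
  Cay S u v = v - u ∈ S

  charSum : Character H → Subset n → ℂ
  charSum χ S = sumᶜ (λ i → if lookup S i then Character.⟦_⟧ χ (from i) else 0ᶜ)

module _ {c ℓ} (H : AbelianGroup c ℓ) {m : ℕ} (order : HasOrder H (suc m)) where
  open Cayley H order

  -- The index 0 is that of the trivial character, which the maximum leaves out.
  -- Starting from 0 does not affect the maximum of a nonempty family of absolute
  -- values; for the group of order 1 the family is empty and the maximum is 0.
  maxCharSum : (Fin (suc m) → Character H) → Subset (suc m) → ℝ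
  maxCharSum χ S = Vector.foldr _⊔ᴿ_ (fromℕ 0) (λ i → ∣ charSum (χ (suc i)) S ∣ᶜ)

  n⋆ : (Fin (suc m) → Character H) → (S : Subset (suc m)) →
       .{{_ : ℕ.NonZero Subset.∣ S ∣}} → ℝ
  n⋆ χ S = fromℚ (+ suc m ℚ./ Subset.∣ S ∣) *ᴿ maxCharSum χ S

{-# OPTIONS --safe #-}
module Submission where

-- The matrix of character values has orthogonal rows.  Its columns D(g) = Σᵢ χᵢ(g) then satisfy
-- Σ_g |D(g)|² = n² = |D(ε)|², so that D vanishes away from ε.  Hence, if there is no edge from X
-- to Y, then Σᵢ Ŝ(χᵢ) X̂(χᵢ) conj Ŷ(χᵢ) = 0, whose trivial term is |S||X||Y|.  Instead of the
-- Cauchy–Schwarz inequality, the other terms are bounded by summing 0 ≤ |α Ŝ X̂ + β Ŷ|², with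
-- Parseval's identity Σᵢ |X̂(χᵢ)|² = n|X|; integer weights α and β make division unnecessary.
-- Having an edge is decidable, so an argument by contradiction suffices.

-- The weights come from a quadratic form. With M the maximum of |Ŝ| over the nontrivial characters,
-- P = M² n|X|, Q = |S||X||Y| and R = n|Y|, the summed squares give 2αβQ ≤ α²P + β²R, and the choice
-- α = R, β = Q turns this into RQ² ≤ R²P. Up to positive factors this is Q² ≤ PR, that is |X||Y| ≤
-- n⋆². The factors are kept, and are only required to be at least 1; empty X and Y are therefore
-- treated apart.
--
-- The obstacle is that the reals are constructive: equality is undecidable, and a number known only
-- to be nonzero has no lower bound to divide by. Equations are instead obtained by cancelling a
-- nonzero factor, by stability of vanishing under double negation, and from vanishing sums of
-- nonnegative terms.
--
-- No classification of finite abelian groups enters. Row orthogonality rests on translation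
-- invariance, and the passage to columns on having as many characters as group elements.

open import Defs
open import Algebra.Bundles using (AbelianGroup; CommutativeRing)
open import Algebra.Morphism.Structures using (IsMagmaHomomorphism)
import Algebra.Properties.CommutativeSemigroup as CommutativeSemigroupProperties
import Algebra.Properties.Group as GroupProperties
import Algebra.Properties.Ring as RingProperties
import Algebra.Properties.Semiring.Sum as SemiringSum
open import Algebra.Structures using (IsCommutativeRing)
open import Data.Bool.Base using (true; false; if_then_else_)
open import Data.Empty using (⊥)
open import Data.Fin.Base using (Fin; zero; suc; punchIn; punchOut)
open import Data.Fin.Permutation using (Permutation′; permutation)
open import Data.Fin.Properties using (any?; punchInᵢ≢i; punchIn-punchOut)
open import Data.Fin.Subset as Subset using (Subset; ∣_∣; inside; outside)
open import Data.Fin.Subset.Properties using () renaming (_∈?_ to _Subset∈?_)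
open import Data.Integer.Base as ℤ using (+_)
import Data.Integer.Properties as ℤ
open import Data.Nat.Base as ℕ using (ℕ; zero; suc)
import Data.Nat.Properties as ℕ
open import Data.Product.Base using (∃-syntax; ∃₂; _×_; _,_; proj₁)
open import Data.Rational.Base as ℚ using (ℚ; 0ℚ; 1ℚ; ½)
import Data.Rational.Properties as ℚ
open import Data.Rational.Solver using (module +-*-Solver)
open import Data.Rational.Unnormalised.Base as ℚᵘ using (ℚᵘ; mkℚᵘ)
import Data.Rational.Unnormalised.Properties as ℚᵘ
open import Data.Sum.Base using (_⊎_; inj₁; inj₂)
open import Data.Vec.Base using ([]; _∷_; lookup)
import Data.Vec.Functional as Vector
open import Data.Vec.Properties using (lookup⇒[]=)
open import Function.Base using (_∘_)
open import Function.Bundles using (Inverse)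
open import Function.Definitions using (Bijective)
open import Level using (0ℓ)
open import Relation.Binary.Bundles using (Poset)
open import Relation.Binary.Core using (Rel)
open import Relation.Binary.PropositionalEquality as ≡
  using (_≡_; _≢_; refl; sym; trans; cong; cong₂; subst)
import Relation.Binary.Reasoning.PartialOrder as PosetReasoning
import Relation.Binary.Reasoning.Setoid as SetoidReasoning
open import Relation.Nullary using (¬_; Dec; yes; no; contradiction; _×-dec_)

open RationalLemmas
open RationalSqrt
open CauchyLemmas
open +-*-Solver using (solve; _:=_; _:+_; _:*_; _:-_; :-_; con)

-- Real numbers

Eventually : (ℕ → Set) → Set
Eventually P = ∃[ N ] (∀ n → N ℕ.≤ n → P n)

always : ∀ {P : ℕ → Set} → (∀ n → P n) → Eventually P
always p = 0 , λ n _ → p n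

infixl 4 _<$>_

_<$>_ : ∀ {P Q : ℕ → Set} → (∀ n → P n → Q n) → Eventually P → Eventually Q
f <$> (N , p) = N , λ n N≤n → f n (p n N≤n)

_∧_ : ∀ {P Q : ℕ → Set} → Eventually P → Eventually Q → Eventually (λ n → P n × Q n)
(M , p) ∧ (N , q) = M ℕ.⊔ N , λ n ≤n →
  p n (ℕ.m⊔n≤o⇒m≤o M N ≤n) , q n (ℕ.m⊔n≤o⇒n≤o M N ≤n)

extract : ∀ {A : Set} → Eventually (λ _ → A) → A
extract (N , p) = p N ℕ.≤-refl

infix 4 _≃ᴿ_ _≤ᴿ_

-- Records, so that the terms can be inferred from a proof; _≈ᴿ_ unfolds.
record _≃ᴿ_ (x y : ℝ) : Set where
  constructor wrap
  field unwrap : x ≈ᴿ y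
open _≃ᴿ_ public

record _≤ᴿ_ (x y : ℝ) : Set where
  constructor wrap
  field unwrap : ∀ ε → 0ℚ ℚ.< ε → Eventually (λ n → seq x n ℚ.< seq y n ℚ.+ ε)
open _≤ᴿ_ public

pointwise-≤ : ∀ {x y} → (∀ n → seq x n ℚ.≤ seq y n) → x ≤ᴿ y
pointwise-≤ p = wrap λ ε 0<ε → always λ n → ℚ.≤-<-trans (p n) (<+ 0<ε)

≃⇒≤ : ∀ {x y} → x ≃ᴿ y → x ≤ᴿ y
≃⇒≤ {x} {y} (wrap p) = wrap λ ε 0<ε → (λ n → near⇒< {seq x n} {seq y n}) <$> p ε 0<ε

≃⇒≥ : ∀ {x y} → x ≃ᴿ y → y ≤ᴿ x
≃⇒≥ {x} {y} (wrap p) = wrap λ ε 0<ε →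
  (λ n h → near⇒< {seq y n} {seq x n} (near-sym {seq x n} {seq y n} h)) <$> p ε 0<ε

≤-antisym : ∀ {x y} → x ≤ᴿ y → y ≤ᴿ x → x ≃ᴿ y
≤-antisym {x} {y} (wrap p) (wrap q) = wrap λ ε 0<ε →
  (λ n (a , b) → <⇒near {seq x n} {seq y n} a b) <$> (p ε 0<ε ∧ q ε 0<ε)

pointwise : ∀ {x y} → (∀ n → seq x n ≡ seq y n) → x ≃ᴿ y
pointwise p = ≤-antisym (pointwise-≤ λ n → ℚ.≤-reflexive (p n))
                        (pointwise-≤ λ n → ℚ.≤-reflexive (sym (p n)))

≤-trans : ∀ {x y z} → x ≤ᴿ y → y ≤ᴿ z → x ≤ᴿ z
≤-trans {x} {y} {z} (wrap p) (wrap q) = wrap λ ε 0<ε →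
  (λ n (a , b) → subst (seq x n ℚ.<_)
      (trans (ℚ.+-assoc (seq z n) (ε ℚ.* ½) (ε ℚ.* ½)) (cong (seq z n ℚ.+_) (½+½ ε)))
      (ℚ.<-trans a (ℚ.+-monoˡ-< (ε ℚ.* ½) b)))
  <$> (p (ε ℚ.* ½) (0<½* 0<ε) ∧ q (ε ℚ.* ½) (0<½* 0<ε))

≃-refl : ∀ {x} → x ≃ᴿ x
≃-refl = pointwise λ _ → refl

≃-sym : ∀ {x y} → x ≃ᴿ y → y ≃ᴿ x
≃-sym p = ≤-antisym (≃⇒≥ p) (≃⇒≤ p)

≃-trans : ∀ {x y z} → x ≃ᴿ y → y ≃ᴿ z → x ≃ᴿ z
≃-trans p q = ≤-antisym (≤-trans (≃⇒≤ p) (≃⇒≤ q)) (≤-trans (≃⇒≥ q) (≃⇒≥ p))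

0ᴿ 1ᴿ : ℝ
0ᴿ = fromℕ 0
1ᴿ = fromℕ 1

infixl 6 _+_
infixl 7 _*_
infix  8 -_

-- Opaque, since comparing two real numbers by unfolding compares their moduli of convergence.
opaque
  _+_ _*_ : ℝ → ℝ → ℝ
  _+_ = _+ᴿ_
  _*_ = _*ᴿ_

  -_ : ℝ → ℝ
  -_ = -ᴿ_

  +-def : ∀ x y → x + y ≡ x +ᴿ y
  +-def _ _ = refl

  *-def : ∀ x y → x * y ≡ x *ᴿ y
  *-def _ _ = refl

  neg-def : ∀ x → - x ≡ -ᴿ x
  neg-def _ = refl

opaque
  unfolding _+_ _*_ -_

  +-cong : ∀ {x x′ y y′} → x ≃ᴿ x′ → y ≃ᴿ y′ → x + y ≃ᴿ x′ + y′
  +-cong {x} {x′} {y} {y′} (wrap p) (wrap q) = wrap λ ε 0<ε →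
    (λ n (a , b) → subst (ℚ.∣ (seq x n ℚ.+ seq y n) ℚ.- (seq x′ n ℚ.+ seq y′ n) ∣ ℚ.<_) (½+½ ε)
      (+-near {seq x n} {seq x′ n} {seq y n} {seq y′ n} a b))
    <$> (p (ε ℚ.* ½) (0<½* 0<ε) ∧ q (ε ℚ.* ½) (0<½* 0<ε))

  neg-cong : ∀ {x x′} → x ≃ᴿ x′ → - x ≃ᴿ - x′
  neg-cong {x} {x′} (wrap p) = wrap λ ε 0<ε →
    (λ n → neg-near {seq x n} {seq x′ n}) <$> p ε 0<ε

  eventuallyBounded : ∀ x → ∃[ B ] 0ℚ ℚ.< B × Eventually (λ n → ℚ.∣ seq x n ∣ ℚ.< B)
  eventuallyBounded x =
    let B , 0<B , N , h = bounded x in B , 0<B , N , λ n N≤n → proj₁ (h n n N≤n N≤n)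

  *-cong : ∀ {x x′ y y′} → x ≃ᴿ x′ → y ≃ᴿ y′ → x * y ≃ᴿ x′ * y′
  *-cong {x} {x′} {y} {y′} (wrap p) (wrap q) = wrap λ ε 0<ε →
    let B , 0<B , x<B = eventuallyBounded x
        C , 0<C , y′<C = eventuallyBounded y′
        δ , 0<δ , small = *-modulus {B} {C} {ε} 0<B 0<C 0<ε
    in (λ n ((a , b) , (c , d)) → ℚ.≤-<-trans
          (*-near {seq x n} {seq x′ n} {seq y n} {seq y′ n} a b c d) small)
       <$> ((x<B ∧ y′<C) ∧ (p δ 0<δ ∧ q δ 0<δ))

  +-assoc : ∀ x y z → (x + y) + z ≃ᴿ x + (y + z)
  +-assoc x y z = pointwise λ n → ℚ.+-assoc (seq x n) (seq y n) (seq z n)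

  +-comm : ∀ x y → x + y ≃ᴿ y + x
  +-comm x y = pointwise λ n → ℚ.+-comm (seq x n) (seq y n)

  +-identityˡ : ∀ x → 0ᴿ + x ≃ᴿ x
  +-identityˡ x = pointwise λ n → ℚ.+-identityˡ (seq x n)

  +-identityʳ : ∀ x → x + 0ᴿ ≃ᴿ x
  +-identityʳ x = pointwise λ n → ℚ.+-identityʳ (seq x n)

  +-inverseˡ : ∀ x → - x + x ≃ᴿ 0ᴿ
  +-inverseˡ x = pointwise λ n → ℚ.+-inverseˡ (seq x n)

  +-inverseʳ : ∀ x → x + - x ≃ᴿ 0ᴿ
  +-inverseʳ x = pointwise λ n → ℚ.+-inverseʳ (seq x n)

  *-assoc : ∀ x y z → (x * y) * z ≃ᴿ x * (y * z)
  *-assoc x y z = pointwise λ n → ℚ.*-assoc (seq x n) (seq y n) (seq z n)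

  *-comm : ∀ x y → x * y ≃ᴿ y * x
  *-comm x y = pointwise λ n → ℚ.*-comm (seq x n) (seq y n)

  *-identityˡ : ∀ x → 1ᴿ * x ≃ᴿ x
  *-identityˡ x = pointwise λ n → ℚ.*-identityˡ (seq x n)

  *-identityʳ : ∀ x → x * 1ᴿ ≃ᴿ x
  *-identityʳ x = pointwise λ n → ℚ.*-identityʳ (seq x n)

  *-distribˡ-+ : ∀ x y z → x * (y + z) ≃ᴿ x * y + x * z
  *-distribˡ-+ x y z = pointwise λ n → ℚ.*-distribˡ-+ (seq x n) (seq y n) (seq z n)

  *-distribʳ-+ : ∀ x y z → (y + z) * x ≃ᴿ y * x + z * x
  *-distribʳ-+ x y z = pointwise λ n → ℚ.*-distribʳ-+ (seq x n) (seq y n) (seq z n)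

ℝ-isCommutativeRing : IsCommutativeRing _≃ᴿ_ _+_ _*_ -_ 0ᴿ 1ᴿ
ℝ-isCommutativeRing = record
  { isRing = record
    { +-isAbelianGroup = record
      { isGroup = record
        { isMonoid = record
          { isSemigroup = record
            { isMagma = record
              { isEquivalence = record { refl = ≃-refl ; sym = ≃-sym ; trans = ≃-trans }
              ; ∙-cong = +-cong }
            ; assoc = +-assoc }
          ; identity = +-identityˡ , +-identityʳ }
        ; inverse = +-inverseˡ , +-inverseʳ
        ; ⁻¹-cong = neg-cong }
      ; comm = +-comm }
    ; *-cong = *-cong
    ; *-assoc = *-assoc
    ; *-identity = *-identityˡ , *-identityʳ
    ; distrib = *-distribˡ-+ , *-distribʳ-+ }
  ; *-comm = *-comm }

ℝ-commutativeRing : CommutativeRing 0ℓ 0ℓ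
ℝ-commutativeRing = record { isCommutativeRing = ℝ-isCommutativeRing }

module ℝ-Ring = CommutativeRing ℝ-commutativeRing

module ≃-Reasoning = SetoidReasoning ℝ-Ring.setoid

-- Order of the reals and its interaction with the ring operations

ℝ-poset : Poset 0ℓ 0ℓ 0ℓ
ℝ-poset = record
  { Carrier = ℝ ; _≈_ = _≃ᴿ_ ; _≤_ = _≤ᴿ_
  ; isPartialOrder = record
    { isPreorder = record
      { isEquivalence = ℝ-Ring.isEquivalence
      ; reflexive = ≃⇒≤
      ; trans = ≤-trans }
    ; antisym = ≤-antisym } }

≤-refl : ∀ {x} → x ≤ᴿ x
≤-refl = ≃⇒≤ ≃-refl

opaque
  unfolding _+_ _*_ -_

  +-mono-≤ : ∀ {x x′ y y′} → x ≤ᴿ x′ → y ≤ᴿ y′ → x + y ≤ᴿ x′ + y′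
  +-mono-≤ {x} {x′} {y} {y′} (wrap p) (wrap q) = wrap λ ε 0<ε →
    (λ n (a , b) → subst (seq x n ℚ.+ seq y n ℚ.<_)
        (trans (solve 3 (λ u v h → (u :+ h) :+ (v :+ h) := (u :+ v) :+ (h :+ h)) refl
                 (seq x′ n) (seq y′ n) (ε ℚ.* ½))
               (cong (seq x′ n ℚ.+ seq y′ n ℚ.+_) (½+½ ε)))
        (ℚ.+-mono-< a b))
    <$> (p (ε ℚ.* ½) (0<½* 0<ε) ∧ q (ε ℚ.* ½) (0<½* 0<ε))

0≤p² : ∀ p → 0ℚ ℚ.≤ p ℚ.* p
0≤p² p with ℚ.∣p∣≡p∨∣p∣≡-p p
... | inj₁ e = 0≤* 0≤p 0≤p
  where
  0≤p : 0ℚ ℚ.≤ p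
  0≤p = subst (0ℚ ℚ.≤_) e (ℚ.0≤∣p∣ p)
... | inj₂ e = subst (0ℚ ℚ.≤_) (solve 1 (λ u → (:- u) :* (:- u) := u :* u) refl p) (0≤* 0≤-p 0≤-p)
  where
  0≤-p : 0ℚ ℚ.≤ ℚ.- p
  0≤-p = subst (0ℚ ℚ.≤_) e (ℚ.0≤∣p∣ p)

0≤x⇒x⊔0≃x : ∀ {x} → 0ᴿ ≤ᴿ x → x ⊔ᴿ 0ᴿ ≃ᴿ x
0≤x⇒x⊔0≃x {x} (wrap p) = ≤-antisym
  (wrap λ ε 0<ε → (λ n 0<x+ε → ⊔-< {seq x n} {0ℚ} (<+ 0<ε) 0<x+ε) <$> p ε 0<ε)
  (pointwise-≤ λ n → ℚ.p≤p⊔q (seq x n) 0ℚ)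

opaque
  unfolding _+_ _*_ -_

  0≤x⊔0*y⊔0 : ∀ x y → 0ᴿ ≤ᴿ (x ⊔ᴿ 0ᴿ) * (y ⊔ᴿ 0ᴿ)
  0≤x⊔0*y⊔0 x y = pointwise-≤ λ n → 0≤* {seq x n ℚ.⊔ 0ℚ} {seq y n ℚ.⊔ 0ℚ}
    (ℚ.p≤q⊔p (seq x n) 0ℚ) (ℚ.p≤q⊔p (seq y n) 0ℚ)

  y-x+x≃y : ∀ x y → y + - x + x ≃ᴿ y
  y-x+x≃y x y = pointwise λ n → solve 2 (λ u v → v :- u :+ u := v) refl (seq x n) (seq y n)

  z*[y-x]≃z*y-z*x : ∀ x y z → z * (y + - x) ≃ᴿ z * y + - (z * x)
  z*[y-x]≃z*y-z*x x y z = pointwise λ n →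
    solve 3 (λ u v w → w :* (v :- u) := w :* v :- w :* u) refl (seq x n) (seq y n) (seq z n)

  0≤x² : ∀ x → 0ᴿ ≤ᴿ x * x
  0≤x² x = pointwise-≤ λ n → 0≤p² (seq x n)

-- A nonnegative real may have negative terms, so the sign of a product cannot be read off termwise.
-- Replacing both factors by their maxima with 0 changes neither number and makes all terms
-- nonnegative.
0≤x*y : ∀ {x y} → 0ᴿ ≤ᴿ x → 0ᴿ ≤ᴿ y → 0ᴿ ≤ᴿ x * y
0≤x*y {x} {y} 0≤x 0≤y = ≤-trans (0≤x⊔0*y⊔0 x y)
  (≃⇒≤ (*-cong (0≤x⇒x⊔0≃x {x} 0≤x) (0≤x⇒x⊔0≃x {y} 0≤y)))

x≤y⇒0≤y-x : ∀ {x y} → x ≤ᴿ y → 0ᴿ ≤ᴿ y + - x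
x≤y⇒0≤y-x {x} x≤y = ≤-trans (≃⇒≥ (+-inverseʳ x)) (+-mono-≤ x≤y ≤-refl)

0≤y-x⇒x≤y : ∀ {x y} → 0ᴿ ≤ᴿ y + - x → x ≤ᴿ y
0≤y-x⇒x≤y {x} {y} h = ≤-trans (≃⇒≥ (+-identityˡ x))
  (≤-trans (+-mono-≤ h ≤-refl) (≃⇒≤ (y-x+x≃y x y)))

*-monoˡ-≤ : ∀ {x y} z → 0ᴿ ≤ᴿ z → x ≤ᴿ y → z * x ≤ᴿ z * y
*-monoˡ-≤ {x} {y} z 0≤z x≤y =
  0≤y-x⇒x≤y (≤-trans (0≤x*y 0≤z (x≤y⇒0≤y-x x≤y)) (≃⇒≤ (z*[y-x]≃z*y-z*x x y z)))

*-mono : ∀ {x x′ y y′} → 0ᴿ ≤ᴿ x → 0ᴿ ≤ᴿ y′ → x ≤ᴿ x′ → y ≤ᴿ y′ → x * y ≤ᴿ x′ * y′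
*-mono {x} {x′} {y} {y′} 0≤x 0≤y′ x≤x′ y≤y′ = ≤-trans (*-monoˡ-≤ x 0≤x y≤y′)
  (≤-trans (≃⇒≤ (*-comm x y′)) (≤-trans (*-monoˡ-≤ y′ 0≤y′ x≤x′) (≃⇒≤ (*-comm y′ x′))))

fromℚ-cancel-≤ : ∀ {p q} → fromℚ p ≤ᴿ fromℚ q → p ℚ.≤ q
fromℚ-cancel-≤ {p} {q} (wrap h) = ℚ.≮⇒≥ λ q<p → ℚ.<-irrefl
  (solve 2 (λ u v → u := v :+ (u :- v)) refl p q)
  (extract (h (p ℚ.- q) (subst (ℚ._< p ℚ.- q) (ℚ.+-inverseʳ q) (ℚ.+-monoˡ-< (ℚ.- q) q<p))))

-- Strict inequality, apartness from zero and cancellation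

infix 4 _≪_

-- `_<ᴿ_` compares terms. Stating the gap through `_≤ᴿ_` lets strictness move along `_≃ᴿ_` by
-- transitivity and keeps a rational witness for the final contradiction.
_≪_ : Rel ℝ 0ℓ
x ≪ y = ∃[ ε ] 0ℚ ℚ.< ε × x + fromℚ ε ≤ᴿ y

opaque
  unfolding _+_

  <ᴿ⇒gap : ∀ {x y} → x <ᴿ y → x ≪ y
  <ᴿ⇒gap (ε , 0<ε , N , h) = ε , 0<ε , wrap λ δ 0<δ → N , λ n N≤n →
    ℚ.<-trans (h n N≤n) (<+ 0<δ)

-- As N is a modulus for ε/4, comparing the N-th term with ε/2 settles all later ones.
small-or-apart : ∀ x ε → 0ℚ ℚ.< ε →
  Eventually (λ n → ℚ.∣ seq x n ∣ ℚ.< ε) ⊎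
  (∃[ δ ] 0ℚ ℚ.< δ × Eventually (λ n → δ ℚ.≤ ℚ.∣ seq x n ∣))
small-or-apart x ε 0<ε with cauchy x (ε ℚ.* ½ ℚ.* ½) (0<½* (0<½* 0<ε))
... | N , h with ℚ.∣ seq x N ∣ ℚ.<? ε ℚ.* ½
...   | yes small = inj₁ (N , λ n N≤n → ℚ.<-trans (ℚ.≤-<-trans
          (subst (λ z → ℚ.∣ z ∣ ℚ.≤ ℚ.∣ seq x N ∣ ℚ.+ ℚ.∣ seq x n ℚ.- seq x N ∣)
            (solve 2 (λ a b → a :+ (b :- a) := b) refl (seq x N) (seq x n))
            (ℚ.∣p+q∣≤∣p∣+∣q∣ (seq x N) (seq x n ℚ.- seq x N)))
          (ℚ.+-mono-< small (h n N N≤n ℕ.≤-refl)))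
          (subst (ε ℚ.* ½ ℚ.+ ε ℚ.* ½ ℚ.* ½ ℚ.<_)
            (solve 1 (λ e → e :* con ½ :+ e :* con ½ :* con ½ :+ e :* con ½ :* con ½ := e) refl ε)
            (<+ (0<½* (0<½* 0<ε)))))
...   | no large = inj₂ (ε ℚ.* ½ ℚ.* ½ , 0<½* (0<½* 0<ε) , N , λ n N≤n →
          ℚ.≮⇒≥ λ xn< → large (ℚ.≤-<-trans
            (subst (λ z → ℚ.∣ z ∣ ℚ.≤ ℚ.∣ seq x n ∣ ℚ.+ ℚ.∣ seq x N ℚ.- seq x n ∣)
              (solve 2 (λ a b → a :+ (b :- a) := b) refl (seq x n) (seq x N))
              (ℚ.∣p+q∣≤∣p∣+∣q∣ (seq x n) (seq x N ℚ.- seq x n)))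
            (subst (ℚ.∣ seq x n ∣ ℚ.+ ℚ.∣ seq x N ℚ.- seq x n ∣ ℚ.<_)
              (½+½ (ε ℚ.* ½)) (ℚ.+-mono-< xn< (h N n ℕ.≤-refl N≤n)))))

∣p-0∣≡∣p∣ : ∀ p → ℚ.∣ p ℚ.- 0ℚ ∣ ≡ ℚ.∣ p ∣
∣p-0∣≡∣p∣ p = cong ℚ.∣_∣ (ℚ.+-identityʳ p)

to-≃0 : ∀ {x} → (∀ ε → 0ℚ ℚ.< ε → Eventually (λ n → ℚ.∣ seq x n ∣ ℚ.< ε)) → x ≃ᴿ 0ᴿ
to-≃0 {x} h = wrap λ ε 0<ε → (λ n → subst (ℚ._< ε) (sym (∣p-0∣≡∣p∣ (seq x n)))) <$> h ε 0<ε

from-≃0 : ∀ {x} → x ≃ᴿ 0ᴿ → ∀ ε → 0ℚ ℚ.< ε → Eventually (λ n → ℚ.∣ seq x n ∣ ℚ.< ε)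
from-≃0 {x} (wrap h) ε 0<ε = (λ n → subst (ℚ._< ε) (∣p-0∣≡∣p∣ (seq x n))) <$> h ε 0<ε

opaque
  unfolding _*_

  -- Division by `y` becomes a comparison of products: η ≤ |xₙ| and δ ≤ |yₙ| would give ηδ ≤ |xₙyₙ|,
  -- which the vanishing product eventually rules out.
  cancel-apart : ∀ {x y δ} → x * y ≃ᴿ 0ᴿ → 0ℚ ℚ.< δ →
                 Eventually (λ n → δ ℚ.≤ ℚ.∣ seq y n ∣) → x ≃ᴿ 0ᴿ
  cancel-apart {x} {y} {δ} xy≃0 0<δ δ≤y = to-≃0 λ η 0<η →
    (λ n (xy<ηδ , δ≤yn) → ℚ.≰⇒> λ η≤xn → ℚ.<-irrefl refl (ℚ.<-≤-trans xy<ηδ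
      (subst (η ℚ.* δ ℚ.≤_) (sym (ℚ.∣p*q∣≡∣p∣*∣q∣ (seq x n) (seq y n)))
        (*-mono-≤ (ℚ.<⇒≤ 0<η) (ℚ.0≤∣p∣ (seq y n)) η≤xn δ≤yn))))
    <$> (from-≃0 xy≃0 (η ℚ.* δ) (0<* 0<η 0<δ) ∧ δ≤y)

-- `¬ x ≃ᴿ 0ᴿ` supplies no lower bound on `x`, so the case distinction is made on `y`, for each ε
-- separately: were `y` apart from 0, then `x` would vanish.
integral : ∀ {x y} → x * y ≃ᴿ 0ᴿ → ¬ x ≃ᴿ 0ᴿ → y ≃ᴿ 0ᴿ
integral {x} {y} xy≃0 x≄0 = to-≃0 λ ε 0<ε → decide ε (small-or-apart y ε 0<ε)
  where
  decide : ∀ ε → _ ⊎ _ → Eventually (λ n → ℚ.∣ seq y n ∣ ℚ.< ε)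
  decide ε (inj₁ small) = small
  decide ε (inj₂ (δ , 0<δ , δ≤y)) = contradiction (cancel-apart {x} {y} xy≃0 0<δ δ≤y) x≄0

-- For a fixed ε, either `x` is eventually below ε or it is apart from 0, and apartness refutes
-- `x ≃ᴿ 0ᴿ`. Equations can thus be proved by contradiction although equality is undecidable.
stable-≃0 : ∀ {x} → ¬ ¬ x ≃ᴿ 0ᴿ → x ≃ᴿ 0ᴿ
stable-≃0 {x} ¬¬x≃0 = to-≃0 λ ε 0<ε → decide ε (small-or-apart x ε 0<ε)
  where
  decide : ∀ ε → _ ⊎ _ → Eventually (λ n → ℚ.∣ seq x n ∣ ℚ.< ε)
  decide ε (inj₁ small) = small
  decide ε (inj₂ (δ , 0<δ , δ≤x)) = contradiction
    (λ x≃0 → extract ((λ n (x<δ , δ≤xn) → ℚ.<-irrefl refl (ℚ.<-≤-trans x<δ δ≤xn))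
      <$> (from-≃0 x≃0 δ 0<δ ∧ δ≤x)))
    ¬¬x≃0

x²≃0⇒x≃0 : ∀ {x} → x * x ≃ᴿ 0ᴿ → x ≃ᴿ 0ᴿ
x²≃0⇒x≃0 x²≃0 = stable-≃0 λ x≄0 → x≄0 (integral x²≃0 x≄0)

x≤0⇒x≃0 : ∀ {x} → 0ᴿ ≤ᴿ x → x ≤ᴿ 0ᴿ → x ≃ᴿ 0ᴿ
x≤0⇒x≃0 0≤x x≤0 = ≤-antisym x≤0 0≤x

-- Square roots

-- l² ≤ q < (l + w)² with l ≤ q + 1 and w = (q + 1)/2ⁿ gives q - l² < 3(q + 1)²/2ⁿ.
√ℚ-error : ∀ {q} → 0ℚ ℚ.≤ q → ∀ n → q ℚ.<
  √ℚ q n ℚ.* √ℚ q n ℚ.+ (q ℚ.+ 1ℚ) ℚ.* (q ℚ.+ 1ℚ) ℚ.* (1ℚ ℚ.+ 1ℚ ℚ.+ 1ℚ) ℚ.* ½^ n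
√ℚ-error {q} 0≤q n = ℚ.<-≤-trans (Bracket.<u² b) (begin
  (l ℚ.+ w) ℚ.* (l ℚ.+ w)
    ≡⟨ solve 2 (λ l w → (l :+ w) :* (l :+ w) := l :* l :+ (l :+ l :+ w) :* w) refl l w ⟩
  l ℚ.* l ℚ.+ (l ℚ.+ l ℚ.+ w) ℚ.* w
    ≤⟨ ℚ.+-monoʳ-≤ (l ℚ.* l) (ℚ.*-monoʳ-≤-nonNeg w {{ℚ.nonNegative (ℚ.<⇒≤ (Bracket.0<w b))}}
         (ℚ.+-mono-≤ (ℚ.+-mono-≤ l≤Q l≤Q) w≤Q)) ⟩
  l ℚ.* l ℚ.+ (Q ℚ.+ Q ℚ.+ Q) ℚ.* w
    ≡⟨ solve 3 (λ l Q h → l :* l :+ (Q :+ Q :+ Q) :* (Q :* h) :=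
         l :* l :+ Q :* Q :* (con 1ℚ :+ con 1ℚ :+ con 1ℚ) :* h) refl l Q (½^ n) ⟩
  l ℚ.* l ℚ.+ Q ℚ.* Q ℚ.* (1ℚ ℚ.+ 1ℚ ℚ.+ 1ℚ) ℚ.* ½^ n ∎)
  where
  open ℚ.≤-Reasoning
  l Q w : ℚ
  l = √ℚ q n
  Q = q ℚ.+ 1ℚ
  w = Q ℚ.* ½^ n
  b : Bracket q l w
  b = √ℚ-bracket 0≤q n
  0≤Q : 0ℚ ℚ.≤ Q
  0≤Q = ℚ.+-mono-≤ 0≤q (ℚ.<⇒≤ (ℚ.positive⁻¹ 1ℚ))
  Q≤Q² : Q ℚ.≤ Q ℚ.* Q
  Q≤Q² = subst (ℚ._≤ Q ℚ.* Q) (ℚ.*-identityʳ Q)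
    (ℚ.*-monoˡ-≤-nonNeg Q {{ℚ.nonNegative 0≤Q}}
      (subst (ℚ._≤ Q) (ℚ.+-identityˡ 1ℚ) (ℚ.+-monoˡ-≤ 1ℚ 0≤q)))
  l≤Q : l ℚ.≤ Q
  l≤Q = ℚ.≮⇒≥ λ Q<l → ℚ.<-irrefl refl (begin-strict
    q          <⟨ <+ (ℚ.positive⁻¹ 1ℚ) ⟩
    Q          ≤⟨ Q≤Q² ⟩
    Q ℚ.* Q    ≤⟨ *-mono-≤ 0≤Q (Bracket.0≤l b) (ℚ.<⇒≤ Q<l) (ℚ.<⇒≤ Q<l) ⟩
    l ℚ.* l    ≤⟨ Bracket.l²≤ b ⟩
    q          ∎)
  w≤Q : w ℚ.≤ Q
  w≤Q = subst (w ℚ.≤_) (ℚ.*-identityʳ Q)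
    (ℚ.*-monoˡ-≤-nonNeg Q {{ℚ.nonNegative 0≤Q}} (½^-antitone (ℕ.≤⇒≤′ (ℕ.z≤n {n}))))

opaque
  unfolding _+_ _*_ -_

  -- The bisection keeps l² ≤ q at every index, which gives one inequality termwise. For the other
  -- the error must tend to 0; as it also grows with q, it is taken at an eventual bound `B` on the
  -- terms, and `C` is the resulting coefficient of 1/2ⁿ.
  √*√ : ∀ x → √ x * √ x ≃ᴿ x ⊔ᴿ 0ᴿ
  √*√ x = ≤-antisym
    (pointwise-≤ λ n → Bracket.l²≤ (√ℚ-bracket (0≤x⁺ n) n))
    (wrap λ ε 0<ε →
      let B , 0<B , x⁺<B = eventuallyBounded (x ⊔ᴿ 0ᴿ)
          b = B ℚ.+ 1ℚ
          0<b = ℚ.+-mono-< 0<B (ℚ.positive⁻¹ 1ℚ)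
          C = b ℚ.* b ℚ.* (1ℚ ℚ.+ 1ℚ ℚ.+ 1ℚ)
      in (λ n (small , x⁺n<B) → ℚ.<-trans (√ℚ-error (0≤x⁺ n) n)
            (ℚ.+-monoʳ-< (seq (√ x) n ℚ.* seq (√ x) n) (ℚ.≤-<-trans
              (ℚ.*-monoʳ-≤-nonNeg (½^ n) {{ℚ.nonNegative (ℚ.<⇒≤ (0<½^ n))}}
                (ℚ.*-monoʳ-≤-nonNeg (1ℚ ℚ.+ 1ℚ ℚ.+ 1ℚ)
                  (*-mono-≤ (0≤x⁺+1 n) (ℚ.<⇒≤ 0<b) (bound n x⁺n<B) (bound n x⁺n<B))))
              small)))
         <$> (½^-small C (0≤* (0≤* (ℚ.<⇒≤ 0<b) (ℚ.<⇒≤ 0<b)) (ℚ.nonNegative⁻¹ (1ℚ ℚ.+ 1ℚ ℚ.+ 1ℚ))) 0<ε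
              ∧ x⁺<B))
    where
    x⁺ : ℕ → ℚ
    x⁺ n = seq x n ℚ.⊔ 0ℚ
    0≤x⁺ : ∀ n → 0ℚ ℚ.≤ x⁺ n
    0≤x⁺ n = ℚ.p≤q⊔p (seq x n) 0ℚ
    0≤x⁺+1 : ∀ n → 0ℚ ℚ.≤ x⁺ n ℚ.+ 1ℚ
    0≤x⁺+1 n = ℚ.+-mono-≤ (0≤x⁺ n) (ℚ.nonNegative⁻¹ 1ℚ)
    bound : ∀ {B} n → ℚ.∣ x⁺ n ∣ ℚ.< B → x⁺ n ℚ.+ 1ℚ ℚ.≤ B ℚ.+ 1ℚ
    bound n h = ℚ.+-monoˡ-≤ 1ℚ (ℚ.≤-trans (p≤∣p∣ (x⁺ n)) (ℚ.<⇒≤ h))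

opaque
  sqrt : ℝ → ℝ
  sqrt = √_

  √≃sqrt : ∀ x → √ x ≃ᴿ sqrt x
  √≃sqrt x = pointwise λ n → refl

  sqrt-def : ∀ x → sqrt x ≡ √ x
  sqrt-def _ = refl

  0≤sqrt : ∀ x → 0ᴿ ≤ᴿ sqrt x
  0≤sqrt x = pointwise-≤ λ n → Bracket.0≤l (√ℚ-bracket (ℚ.p≤q⊔p (seq x n) 0ℚ) n)

  sqrt*sqrt : ∀ {x} → 0ᴿ ≤ᴿ x → sqrt x * sqrt x ≃ᴿ x
  sqrt*sqrt {x} 0≤x = ≃-trans (√*√ x) (0≤x⇒x⊔0≃x {x} 0≤x)

-- Natural and rational constants

ι≡ : ∀ n → ι n ≡ + n ℚ./ 1
ι≡ n = sym (ℚ.↥p/↧p≡p (ι n))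

opaque
  unfolding _+_ _*_

  -- The fraction `+ n / 1` is reduced by a gcd that does not compute for a variable `n`; `ι n` is
  -- the same rational, built in lowest terms, and its successor law is carried over.
  fromℕ-suc : ∀ n → fromℕ (suc n) ≃ᴿ 1ᴿ + fromℕ n
  fromℕ-suc n = pointwise λ _ → trans (sym (ι≡ (suc n)))
    (trans (ι-suc n) (cong (1ℚ ℚ.+_) (ι≡ n)))

  fromℚ-mono-≤ : ∀ {p q} → p ℚ.≤ q → fromℚ p ≤ᴿ fromℚ q
  fromℚ-mono-≤ p≤q = pointwise-≤ λ _ → p≤q

  fromℚ-* : ∀ p q → fromℚ p * fromℚ q ≃ᴿ fromℚ (p ℚ.* q)
  fromℚ-* p q = pointwise λ _ → refl

0≤1 : 0ᴿ ≤ᴿ 1ᴿ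
0≤1 = fromℚ-mono-≤ (ℚ.nonNegative⁻¹ 1ℚ)

0≤fromℕ : ∀ n → 0ᴿ ≤ᴿ fromℕ n
0≤fromℕ zero = ≤-refl
0≤fromℕ (suc n) = ≤-trans (≃⇒≥ (+-identityʳ 0ᴿ))
  (≤-trans (+-mono-≤ 0≤1 (0≤fromℕ n)) (≃⇒≥ (fromℕ-suc n)))

1≤fromℕ : ∀ n .{{_ : ℕ.NonZero n}} → 1ᴿ ≤ᴿ fromℕ n
1≤fromℕ (suc n) = ≤-trans (≃⇒≥ (+-identityʳ 1ᴿ))
  (≤-trans (+-mono-≤ ≤-refl (0≤fromℕ n)) (≃⇒≥ (fromℕ-suc n)))

fromℕ-+ : ∀ m n → fromℕ (m ℕ.+ n) ≃ᴿ fromℕ m + fromℕ n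
fromℕ-+ zero n = ≃-sym (+-identityˡ (fromℕ n))
fromℕ-+ (suc m) n = begin
  fromℕ (suc (m ℕ.+ n))        ≈⟨ fromℕ-suc (m ℕ.+ n) ⟩
  1ᴿ + fromℕ (m ℕ.+ n)         ≈⟨ +-cong ≃-refl (fromℕ-+ m n) ⟩
  1ᴿ + (fromℕ m + fromℕ n)     ≈⟨ +-assoc 1ᴿ (fromℕ m) (fromℕ n) ⟨
  1ᴿ + fromℕ m + fromℕ n       ≈⟨ +-cong (fromℕ-suc m) ≃-refl ⟨
  fromℕ (suc m) + fromℕ n      ∎
  where open ≃-Reasoning

fromℕ-* : ∀ m n → fromℕ (m ℕ.* n) ≃ᴿ fromℕ m * fromℕ n
fromℕ-* zero n = ≃-sym (ℝ-Ring.zeroˡ (fromℕ n))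
fromℕ-* (suc m) n = begin
  fromℕ (n ℕ.+ m ℕ.* n)                ≈⟨ fromℕ-+ n (m ℕ.* n) ⟩
  fromℕ n + fromℕ (m ℕ.* n)            ≈⟨ +-cong (≃-sym (*-identityˡ (fromℕ n))) (fromℕ-* m n) ⟩
  1ᴿ * fromℕ n + fromℕ m * fromℕ n     ≈⟨ *-distribʳ-+ (fromℕ n) 1ᴿ (fromℕ m) ⟨
  (1ᴿ + fromℕ m) * fromℕ n             ≈⟨ *-cong (fromℕ-suc m) ≃-refl ⟨
  fromℕ (suc m) * fromℕ n              ∎
  where open ≃-Reasoning

-- Reduction to lowest terms blocks computation in `ℚ`. Among unnormalised fractions the equation is
-- a cross-multiplication of integers.
n*m/n≡m : ∀ m n .{{_ : ℕ.NonZero n}} → (+ n ℚ./ 1) ℚ.* (+ m ℚ./ n) ≡ + m ℚ./ 1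
n*m/n≡m m (suc k) = ℚ.toℚᵘ-injective (begin
  ℚ.toℚᵘ (ℚ.fromℚᵘ a ℚ.* ℚ.fromℚᵘ b)            ≈⟨ ℚ.toℚᵘ-homo-* (ℚ.fromℚᵘ a) (ℚ.fromℚᵘ b) ⟩
  ℚ.toℚᵘ (ℚ.fromℚᵘ a) ℚᵘ.* ℚ.toℚᵘ (ℚ.fromℚᵘ b)  ≈⟨ ℚᵘ.*-cong (ℚ.toℚᵘ-fromℚᵘ a) (ℚ.toℚᵘ-fromℚᵘ b) ⟩
  a ℚᵘ.* b                                      ≈⟨ ℚᵘ.*≡* (trans (ℤ.*-identityʳ (+ suc k ℤ.* + m))
                                                     (trans (ℤ.*-comm (+ suc k) (+ m))
                                                       (cong (λ j → + m ℤ.* + j) (sym (ℕ.*-identityˡ (suc k)))))) ⟩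
  c                                             ≈⟨ ℚ.toℚᵘ-fromℚᵘ c ⟨
  ℚ.toℚᵘ (ℚ.fromℚᵘ c)                           ∎)
  where
  open SetoidReasoning ℚᵘ.≃-setoid
  a b c : ℚᵘ
  a = mkℚᵘ (+ suc k) 0
  b = mkℚᵘ (+ m) k
  c = mkℚᵘ (+ m) 0

fromℕ*fromℚ/ : ∀ m n .{{_ : ℕ.NonZero n}} → fromℕ n * fromℚ (+ m ℚ./ n) ≃ᴿ fromℕ m
fromℕ*fromℚ/ m n = ≃-trans (fromℚ-* (+ n ℚ./ 1) (+ m ℚ./ n)) (pointwise λ _ → n*m/n≡m m n)

-- Complex numbers

infix  4 _≃ᶜ_
infixl 6 _⊞_
infixl 7 _⊠_
infix  8 ⊟_

record _≃ᶜ_ (z w : ℂ) : Set where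
  constructor _,_
  field
    re≃ : re z ≃ᴿ re w
    im≃ : im z ≃ᴿ im w
open _≃ᶜ_ public

≈⇒≃ : ∀ {z w} → z ≈ᶜ w → z ≃ᶜ w
≈⇒≃ (p , q) = wrap p , wrap q

≃⇒≈ : ∀ {z w} → z ≃ᶜ w → z ≈ᶜ w
≃⇒≈ (p , q) = unwrap p , unwrap q

≃ᶜ-refl : ∀ {z} → z ≃ᶜ z
≃ᶜ-refl = ≃-refl , ≃-refl

≃ᶜ-sym : ∀ {z w} → z ≃ᶜ w → w ≃ᶜ z
≃ᶜ-sym (p , q) = ≃-sym p , ≃-sym q

≃ᶜ-trans : ∀ {z w v} → z ≃ᶜ w → w ≃ᶜ v → z ≃ᶜ v
≃ᶜ-trans (p , q) (p′ , q′) = ≃-trans p p′ , ≃-trans q q′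

real : ℝ → ℂ
real x = x +i 0ᴿ

opaque
  _⊞_ _⊠_ : ℂ → ℂ → ℂ
  z ⊞ w = (re z + re w) +i (im z + im w)
  z ⊠ w = (re z * re w + - (im z * im w)) +i (re z * im w + im z * re w)

  ⊟_ conj : ℂ → ℂ
  ⊟ z = (- re z) +i (- im z)
  conj z = re z +i (- im z)

  normSq : ℂ → ℝ
  normSq z = re z * re z + im z * im z

opaque
  unfolding _⊞_

  ⊞-def : ∀ z w → z ⊞ w ≡ z +ᶜ w
  ⊞-def z w = cong₂ _+i_ (+-def (re z) (re w)) (+-def (im z) (im w))

  ⊠-def : ∀ z w → z ⊠ w ≡ z *ᶜ w
  ⊠-def z w = cong₂ _+i_
    (trans (cong₂ (λ a b → a + (- b)) (*-def (re z) (re w)) (*-def (im z) (im w)))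
      (trans (cong (λ b → re z *ᴿ re w + b) (neg-def (im z *ᴿ im w))) (+-def (re z *ᴿ re w) (-ᴿ (im z *ᴿ im w)))))
    (trans (cong₂ _+_ (*-def (re z) (im w)) (*-def (im z) (re w)))
      (+-def (re z *ᴿ im w) (im z *ᴿ re w)))

  normSq-def : ∀ z → normSq z ≡ re z *ᴿ re z +ᴿ im z *ᴿ im z
  normSq-def z = trans (cong₂ _+_ (*-def (re z) (re z)) (*-def (im z) (im z)))
    (+-def (re z *ᴿ re z) (im z *ᴿ im z))

  re-⊞ : ∀ z w → re (z ⊞ w) ≡ re z + re w
  re-⊞ z w = refl

  ⊞-cong : ∀ {z z′ w w′} → z ≃ᶜ z′ → w ≃ᶜ w′ → z ⊞ w ≃ᶜ z′ ⊞ w′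
  ⊞-cong (p , p′) (q , q′) = +-cong p q , +-cong p′ q′

  ⊠-cong : ∀ {z z′ w w′} → z ≃ᶜ z′ → w ≃ᶜ w′ → z ⊠ w ≃ᶜ z′ ⊠ w′
  ⊠-cong (p , p′) (q , q′) =
    +-cong (*-cong p q) (neg-cong (*-cong p′ q′)) , +-cong (*-cong p q′) (*-cong p′ q)

  ⊟-cong : ∀ {z z′} → z ≃ᶜ z′ → ⊟ z ≃ᶜ ⊟ z′
  ⊟-cong (p , p′) = neg-cong p , neg-cong p′

  conj-cong : ∀ {z z′} → z ≃ᶜ z′ → conj z ≃ᶜ conj z′
  conj-cong (p , p′) = p , neg-cong p′

  0≤normSq : ∀ z → 0ᴿ ≤ᴿ normSq z
  0≤normSq z = ≤-trans (≃⇒≥ (+-identityˡ 0ᴿ)) (+-mono-≤ (0≤x² (re z)) (0≤x² (im z)))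

  normSq≃0⇒≃0 : ∀ {z} → normSq z ≃ᴿ 0ᴿ → z ≃ᶜ 0ᶜ
  normSq≃0⇒≃0 {z} |z|²≃0 =
    x²≃0⇒x≃0 (x≤0⇒x≃0 (0≤x² (re z)) (≤-trans re²≤ (≃⇒≤ |z|²≃0))) ,
    x²≃0⇒x≃0 (x≤0⇒x≃0 (0≤x² (im z)) (≤-trans im²≤ (≃⇒≤ |z|²≃0)))
    where
    re²≤ : re z * re z ≤ᴿ normSq z
    re²≤ = ≤-trans (≃⇒≥ (+-identityʳ (re z * re z))) (+-mono-≤ ≤-refl (0≤x² (im z)))
    im²≤ : im z * im z ≤ᴿ normSq z
    im²≤ = ≤-trans (≃⇒≥ (+-identityˡ (im z * im z))) (+-mono-≤ (0≤x² (re z)) ≤-refl)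

opaque
  unfolding _⊞_

  ⊞-assoc : ∀ z w v → (z ⊞ w) ⊞ v ≃ᶜ z ⊞ (w ⊞ v)
  ⊞-assoc z w v = +-assoc (re z) (re w) (re v) , +-assoc (im z) (im w) (im v)

  ⊞-comm : ∀ z w → z ⊞ w ≃ᶜ w ⊞ z
  ⊞-comm z w = +-comm (re z) (re w) , +-comm (im z) (im w)

  ⊞-identityˡ : ∀ z → 0ᶜ ⊞ z ≃ᶜ z
  ⊞-identityˡ z = +-identityˡ (re z) , +-identityˡ (im z)

  ⊞-identityʳ : ∀ z → z ⊞ 0ᶜ ≃ᶜ z
  ⊞-identityʳ z = +-identityʳ (re z) , +-identityʳ (im z)

  ⊞-inverseˡ : ∀ z → ⊟ z ⊞ z ≃ᶜ 0ᶜ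
  ⊞-inverseˡ z = +-inverseˡ (re z) , +-inverseˡ (im z)

  ⊞-inverseʳ : ∀ z → z ⊞ ⊟ z ≃ᶜ 0ᶜ
  ⊞-inverseʳ z = +-inverseʳ (re z) , +-inverseʳ (im z)

opaque
  unfolding _⊞_ _+_

  -- Real sums, products and negatives are taken term by term, so a complex identity amounts to
  -- polynomial identities over `ℚ` in the real and imaginary parts, at each index. The identities
  -- that follow are obtained in the same way.
  ⊠-assoc : ∀ z w v → (z ⊠ w) ⊠ v ≃ᶜ z ⊠ (w ⊠ v)
  ⊠-assoc z w v =
    (pointwise λ n → solve 6 (λ a a′ b b′ c c′ →
        (a :* b :- a′ :* b′) :* c :- (a :* b′ :+ a′ :* b) :* c′ :=
        a :* (b :* c :- b′ :* c′) :- a′ :* (b :* c′ :+ b′ :* c)) refl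
      (seq (re z) n) (seq (im z) n) (seq (re w) n) (seq (im w) n) (seq (re v) n) (seq (im v) n)) ,
    (pointwise λ n → solve 6 (λ a a′ b b′ c c′ →
        (a :* b :- a′ :* b′) :* c′ :+ (a :* b′ :+ a′ :* b) :* c :=
        a :* (b :* c′ :+ b′ :* c) :+ a′ :* (b :* c :- b′ :* c′)) refl
      (seq (re z) n) (seq (im z) n) (seq (re w) n) (seq (im w) n) (seq (re v) n) (seq (im v) n))

  ⊠-comm : ∀ z w → z ⊠ w ≃ᶜ w ⊠ z
  ⊠-comm z w =
    (pointwise λ n → solve 4 (λ a a′ b b′ → a :* b :- a′ :* b′ := b :* a :- b′ :* a′) refl
      (seq (re z) n) (seq (im z) n) (seq (re w) n) (seq (im w) n)) ,
    (pointwise λ n → solve 4 (λ a a′ b b′ → a :* b′ :+ a′ :* b := b :* a′ :+ b′ :* a) refl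
      (seq (re z) n) (seq (im z) n) (seq (re w) n) (seq (im w) n))

  ⊠-identityˡ : ∀ z → 1ᶜ ⊠ z ≃ᶜ z
  ⊠-identityˡ z =
    (pointwise λ n → solve 2 (λ a a′ → con 1ℚ :* a :- con 0ℚ :* a′ := a) refl
      (seq (re z) n) (seq (im z) n)) ,
    (pointwise λ n → solve 2 (λ a a′ → con 1ℚ :* a′ :+ con 0ℚ :* a := a′) refl
      (seq (re z) n) (seq (im z) n))

  ⊠-distribˡ-⊞ : ∀ z w v → z ⊠ (w ⊞ v) ≃ᶜ z ⊠ w ⊞ z ⊠ v
  ⊠-distribˡ-⊞ z w v =
    (pointwise λ n → solve 6 (λ a a′ b b′ c c′ →
        a :* (b :+ c) :- a′ :* (b′ :+ c′) := (a :* b :- a′ :* b′) :+ (a :* c :- a′ :* c′)) refl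
      (seq (re z) n) (seq (im z) n) (seq (re w) n) (seq (im w) n) (seq (re v) n) (seq (im v) n)) ,
    (pointwise λ n → solve 6 (λ a a′ b b′ c c′ →
        a :* (b′ :+ c′) :+ a′ :* (b :+ c) := (a :* b′ :+ a′ :* b) :+ (a :* c′ :+ a′ :* c)) refl
      (seq (re z) n) (seq (im z) n) (seq (re w) n) (seq (im w) n) (seq (re v) n) (seq (im v) n))

  conj-⊞ : ∀ z w → conj (z ⊞ w) ≃ᶜ conj z ⊞ conj w
  conj-⊞ z w = (pointwise λ n → refl) , (pointwise λ n → ℚ.neg-distrib-+ (seq (im z) n) (seq (im w) n))

  conj-⊠ : ∀ z w → conj (z ⊠ w) ≃ᶜ conj z ⊠ conj w
  conj-⊠ z w =
    (pointwise λ n → solve 4 (λ a a′ b b′ →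
        a :* b :- a′ :* b′ := a :* b :- (:- a′) :* (:- b′)) refl
      (seq (re z) n) (seq (im z) n) (seq (re w) n) (seq (im w) n)) ,
    (pointwise λ n → solve 4 (λ a a′ b b′ →
        :- (a :* b′ :+ a′ :* b) := a :* (:- b′) :+ (:- a′) :* b) refl
      (seq (re z) n) (seq (im z) n) (seq (re w) n) (seq (im w) n))

  conj-real : ∀ x → conj (real x) ≃ᶜ real x
  conj-real x = (pointwise λ n → refl) , pointwise λ n → refl

  real-+ : ∀ x y → real (x + y) ≃ᶜ real x ⊞ real y
  real-+ x y = (pointwise λ n → refl) , pointwise λ n → refl

  real-⊠ : ∀ x z → real x ⊠ z ≃ᶜ (x * re z) +i (x * im z)
  real-⊠ x z =
    (pointwise λ n → solve 3 (λ r a a′ → r :* a :- con 0ℚ :* a′ := r :* a) refl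
      (seq x n) (seq (re z) n) (seq (im z) n)) ,
    (pointwise λ n → solve 3 (λ r a a′ → r :* a′ :+ con 0ℚ :* a := r :* a′) refl
      (seq x n) (seq (re z) n) (seq (im z) n))

  normSq-⊠ : ∀ z w → normSq (z ⊠ w) ≃ᴿ normSq z * normSq w
  normSq-⊠ z w = pointwise λ n → solve 4 (λ a a′ b b′ →
      (a :* b :- a′ :* b′) :* (a :* b :- a′ :* b′) :+ (a :* b′ :+ a′ :* b) :* (a :* b′ :+ a′ :* b) :=
      (a :* a :+ a′ :* a′) :* (b :* b :+ b′ :* b′)) refl
    (seq (re z) n) (seq (im z) n) (seq (re w) n) (seq (im w) n)

  z⊠conj-z : ∀ z → z ⊠ conj z ≃ᶜ real (normSq z)
  z⊠conj-z z =
    (pointwise λ n → solve 2 (λ a a′ → a :* a :- a′ :* (:- a′) := a :* a :+ a′ :* a′) refl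
      (seq (re z) n) (seq (im z) n)) ,
    (pointwise λ n → solve 2 (λ a a′ → a :* (:- a′) :+ a′ :* a := con 0ℚ) refl
      (seq (re z) n) (seq (im z) n))

  -- Polarisation with real weights. For z = Ŝ X̂ and w = Ŷ the cross term is the real part of the
  -- triple correlation, whose sum over all characters vanishes when there is no edge.
  normSq-combination : ∀ α β z w → normSq (real α ⊠ z ⊞ real β ⊠ w) ≃ᴿ
    α * α * normSq z + (1ᴿ + 1ᴿ) * (α * β) * re (z ⊠ conj w) + β * β * normSq w
  normSq-combination α β z w = pointwise λ n → solve 6 (λ r s a a′ b b′ →
      (r :* a :- con 0ℚ :* a′ :+ (s :* b :- con 0ℚ :* b′)) :*
      (r :* a :- con 0ℚ :* a′ :+ (s :* b :- con 0ℚ :* b′)) :+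
      (r :* a′ :+ con 0ℚ :* a :+ (s :* b′ :+ con 0ℚ :* b)) :*
      (r :* a′ :+ con 0ℚ :* a :+ (s :* b′ :+ con 0ℚ :* b)) :=
      r :* r :* (a :* a :+ a′ :* a′) :+
      (con 1ℚ :+ con 1ℚ) :* (r :* s) :* (a :* b :- a′ :* (:- b′)) :+
      s :* s :* (b :* b :+ b′ :* b′)) refl
    (seq α n) (seq β n) (seq (re z) n) (seq (im z) n) (seq (re w) n) (seq (im w) n)

ℂ-isCommutativeRing : IsCommutativeRing _≃ᶜ_ _⊞_ _⊠_ ⊟_ 0ᶜ 1ᶜ
ℂ-isCommutativeRing = record
  { isRing = record
    { +-isAbelianGroup = record
      { isGroup = record
        { isMonoid = record
          { isSemigroup = record
            { isMagma = record
              { isEquivalence = record { refl = ≃ᶜ-refl ; sym = ≃ᶜ-sym ; trans = ≃ᶜ-trans }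
              ; ∙-cong = ⊞-cong }
            ; assoc = ⊞-assoc }
          ; identity = ⊞-identityˡ , ⊞-identityʳ }
        ; inverse = ⊞-inverseˡ , ⊞-inverseʳ
        ; ⁻¹-cong = ⊟-cong }
      ; comm = ⊞-comm }
    ; *-cong = ⊠-cong
    ; *-assoc = ⊠-assoc
    ; *-identity = ⊠-identityˡ , λ z → ≃ᶜ-trans (⊠-comm z 1ᶜ) (⊠-identityˡ z)
    ; distrib = ⊠-distribˡ-⊞ , λ z w v → ≃ᶜ-trans (⊠-comm (w ⊞ v) z)
        (≃ᶜ-trans (⊠-distribˡ-⊞ z w v) (⊞-cong (⊠-comm z w) (⊠-comm z v))) }
  ; *-comm = ⊠-comm }

ℂ-commutativeRing : CommutativeRing 0ℓ 0ℓ
ℂ-commutativeRing = record { isCommutativeRing = ℂ-isCommutativeRing }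

module ℂ-Ring = CommutativeRing ℂ-commutativeRing
module ≃ᶜ-Reasoning = SetoidReasoning ℂ-Ring.setoid
module ≤-Reasoning = PosetReasoning ℝ-poset

-- Finite sums

module RingSums {c ℓ} (R : CommutativeRing c ℓ) where
  open CommutativeRing R using (Carrier; _≈_; 0#; semiring; setoid)
    renaming (_+_ to _⊕_; _*_ to _⊗_; refl to ≈-refl; sym to ≈-sym; trans to ≈-trans;
              +-cong to ⊕-cong; *-cong to ⊗-cong; +-identityˡ to ⊕-identityˡ; +-identityʳ to ⊕-identityʳ)
  open SemiringSum semiring public
  open SetoidReasoning setoid

  sum-cong : ∀ {n} {f g : Fin n → Carrier} → (∀ i → f i ≈ g i) → sum f ≈ sum g
  sum-cong {n} {f} {g} = sum-cong-≋ {n} {f} {g}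

  sum-zero : ∀ {n} {f : Fin n → Carrier} → (∀ i → f i ≈ 0#) → sum f ≈ 0#
  sum-zero {n} f≈0 = ≈-trans (sum-cong f≈0) (sum-replicate-zero n)

  sum-single : ∀ {n} {f : Fin n → Carrier} i → (∀ j → j ≢ i → f j ≈ 0#) → sum f ≈ f i
  sum-single {suc n} {f} i f≈0 = begin
    sum f                            ≈⟨ sum-remove {i = i} f ⟩
    f i ⊕ sum (Vector.removeAt f i)  ≈⟨ ⊕-cong ≈-refl (sum-zero λ j → f≈0 (punchIn i j) (punchInᵢ≢i i j)) ⟩
    f i ⊕ 0#                         ≈⟨ ⊕-identityʳ (f i) ⟩
    f i                              ∎

  sum-⊗-sum : ∀ {m n} (f : Fin m → Carrier) (g : Fin n → Carrier) →
              sum f ⊗ sum g ≈ sum (λ i → sum (λ j → f i ⊗ g j))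
  sum-⊗-sum f g = ≈-trans (*-distribʳ-sum (sum g) f) (sum-cong λ i → *-distribˡ-sum (f i) g)

  sum-⊗-sum-⊗-sum : ∀ {k m n} (f : Fin k → Carrier) (g : Fin m → Carrier) (h : Fin n → Carrier) →
    sum f ⊗ sum g ⊗ sum h ≈ sum (λ i → sum (λ j → sum (λ l → f i ⊗ g j ⊗ h l)))
  sum-⊗-sum-⊗-sum f g h = begin
    sum f ⊗ sum g ⊗ sum h                                  ≈⟨ ⊗-cong (sum-⊗-sum f g) ≈-refl ⟩
    sum (λ i → sum (λ j → f i ⊗ g j)) ⊗ sum h              ≈⟨ *-distribʳ-sum (sum h) (λ i → sum (λ j → f i ⊗ g j)) ⟩
    sum (λ i → sum (λ j → f i ⊗ g j) ⊗ sum h)              ≈⟨ sum-cong (λ i → sum-⊗-sum (λ j → f i ⊗ g j) h) ⟩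
    sum (λ i → sum (λ j → sum (λ l → f i ⊗ g j ⊗ h l)))    ∎

module ℝ-Sum = RingSums ℝ-commutativeRing
module ℂ-Sum = RingSums ℂ-commutativeRing

Σᴿ : ∀ {n} → (Fin n → ℝ) → ℝ
Σᴿ = ℝ-Sum.sum

Σᶜ : ∀ {n} → (Fin n → ℂ) → ℂ
Σᶜ = ℂ-Sum.sum

re-Σ : ∀ {n} (f : Fin n → ℂ) → re (Σᶜ f) ≡ Σᴿ (re ∘ f)
re-Σ {zero} f = refl
re-Σ {suc n} f = trans (re-⊞ (f zero) (Σᶜ (f ∘ suc))) (cong (λ x → re (f zero) + x) (re-Σ (f ∘ suc)))

Σ-real : ∀ {n} (f : Fin n → ℝ) → Σᶜ (real ∘ f) ≃ᶜ real (Σᴿ f)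
Σ-real {zero} f = ≃ᶜ-refl
Σ-real {suc n} f = ≃ᶜ-trans (⊞-cong ≃ᶜ-refl (Σ-real (f ∘ suc))) (≃ᶜ-sym (real-+ (f zero) (Σᴿ (f ∘ suc))))

conj-Σ : ∀ {n} (f : Fin n → ℂ) → conj (Σᶜ f) ≃ᶜ Σᶜ (conj ∘ f)
conj-Σ {zero} f = conj-real 0ᴿ
conj-Σ {suc n} f = ≃ᶜ-trans (conj-⊞ (f zero) (Σᶜ (f ∘ suc))) (⊞-cong ≃ᶜ-refl (conj-Σ (f ∘ suc)))

Σ-mono : ∀ {n} {f g : Fin n → ℝ} → (∀ i → f i ≤ᴿ g i) → Σᴿ f ≤ᴿ Σᴿ g
Σ-mono {zero} f≤g = ≤-refl
Σ-mono {suc n} f≤g = +-mono-≤ (f≤g zero) (Σ-mono (f≤g ∘ suc))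

0≤Σ : ∀ {n} {f : Fin n → ℝ} → (∀ i → 0ᴿ ≤ᴿ f i) → 0ᴿ ≤ᴿ Σᴿ f
0≤Σ {n} 0≤f = ≤-trans (≃⇒≥ (ℝ-Sum.sum-replicate-zero n)) (Σ-mono 0≤f)

term≤Σ : ∀ {n} {f : Fin n → ℝ} → (∀ i → 0ᴿ ≤ᴿ f i) → ∀ i → f i ≤ᴿ Σᴿ f
term≤Σ {suc n} {f} 0≤f i = begin
  f i                               ≈⟨ +-identityʳ (f i) ⟨
  f i + 0ᴿ                          ≤⟨ +-mono-≤ ≤-refl (0≤Σ λ j → 0≤f (punchIn i j)) ⟩
  f i + Σᴿ (Vector.removeAt f i)    ≈⟨ ℝ-Sum.sum-remove {i = i} f ⟨
  Σᴿ f                              ∎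
  where open ≤-Reasoning

Σ≃0⇒term≃0 : ∀ {n} {f : Fin n → ℝ} → (∀ i → 0ᴿ ≤ᴿ f i) → Σᴿ f ≃ᴿ 0ᴿ → ∀ i → f i ≃ᴿ 0ᴿ
Σ≃0⇒term≃0 0≤f Σ≃0 i = x≤0⇒x≃0 (0≤f i) (≤-trans (term≤Σ 0≤f i) (≃⇒≤ Σ≃0))

-- Cancelling the `i`-th term leaves a vanishing sum of nonnegative terms over the other indices,
-- among which `j` is found by `punchOut`.
Σ≃term⇒others≃0 : ∀ {n} {f : Fin n → ℝ} → (∀ i → 0ᴿ ≤ᴿ f i) →
                  ∀ {i j} → Σᴿ f ≃ᴿ f i → j ≢ i → f j ≃ᴿ 0ᴿ
Σ≃term⇒others≃0 {suc n} {f} 0≤f {i} {j} Σ≃fi j≢i =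
  subst (λ k → f k ≃ᴿ 0ᴿ) (punchIn-punchOut (j≢i ∘ sym))
    (Σ≃0⇒term≃0 (λ k → 0≤f (punchIn i k)) rest≃0 (punchOut (j≢i ∘ sym)))
  where
  rest≃0 : Σᴿ (Vector.removeAt f i) ≃ᴿ 0ᴿ
  rest≃0 = ∙-cancelˡ (f i) _ _ (≃-trans (≃-sym (ℝ-Sum.sum-remove {i = i} f))
    (≃-trans Σ≃fi (≃-sym (+-identityʳ (f i)))))
    where open GroupProperties ℝ-Ring.+-group using (∙-cancelˡ)

-- No zero divisors among the complex numbers

normSq-0 : ∀ {z} → z ≃ᶜ 0ᶜ → normSq z ≃ᴿ 0ᴿ
normSq-0 {z} z≃0 = re≃ (begin
  real (normSq z)   ≈⟨ z⊠conj-z z ⟨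
  z ⊠ conj z        ≈⟨ ⊠-cong z≃0 ≃ᶜ-refl ⟩
  0ᶜ ⊠ conj z       ≈⟨ ℂ-Ring.zeroˡ (conj z) ⟩
  0ᶜ                ∎)
  where open ≃ᶜ-Reasoning

-- The squared modulus is multiplicative and detects 0, so the claim descends to the reals.
integralᶜ : ∀ {z w} → z ⊠ w ≃ᶜ 0ᶜ → ¬ z ≃ᶜ 0ᶜ → w ≃ᶜ 0ᶜ
integralᶜ {z} {w} zw≃0 z≄0 = normSq≃0⇒≃0
  (integral (≃-trans (≃-sym (normSq-⊠ z w)) (normSq-0 zw≃0)) (z≄0 ∘ normSq≃0⇒≃0))

stable-≃ᶜ0 : ∀ {z} → ¬ ¬ z ≃ᶜ 0ᶜ → z ≃ᶜ 0ᶜ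
stable-≃ᶜ0 ¬¬z≃0 = stable-≃0 (λ ¬re → ¬¬z≃0 (¬re ∘ re≃)) , stable-≃0 (λ ¬im → ¬¬z≃0 (¬im ∘ im≃))

-- The form in which cancellation is used for characters: χ(ε) fixes itself, while |χ(h)|² and χ(h)
-- conj ψ(h) fix the inner products of χ with itself and with ψ.
⊠-fixed⇒≃1 : ∀ {z w} → w ⊠ z ≃ᶜ z → ¬ z ≃ᶜ 0ᶜ → w ≃ᶜ 1ᶜ
⊠-fixed⇒≃1 {z} {w} wz≃z z≄0 = GroupProperties.x∙y⁻¹≈ε⇒x≈y ℂ-Ring.+-group w 1ᶜ
  (integralᶜ {z} (begin
    z ⊠ (w ⊞ ⊟ 1ᶜ)        ≈⟨ ⊠-distribˡ-⊞ z w (⊟ 1ᶜ) ⟩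
    z ⊠ w ⊞ z ⊠ ⊟ 1ᶜ      ≈⟨ ⊞-cong (≃ᶜ-trans (⊠-comm z w) wz≃z) z⊠-1 ⟩
    z ⊞ ⊟ z               ≈⟨ ⊞-inverseʳ z ⟩
    0ᶜ                    ∎) z≄0)
  where
  open ≃ᶜ-Reasoning
  z⊠-1 : z ⊠ ⊟ 1ᶜ ≃ᶜ ⊟ z
  z⊠-1 = ≃ᶜ-trans (≃ᶜ-sym (-‿distribʳ-* z 1ᶜ)) (⊟-cong (ℂ-Ring.*-identityʳ z))
    where open RingProperties ℂ-Ring.ring

natᶜ : ℕ → ℂ
natᶜ k = real (fromℕ k)

natᶜ-suc-⊠ : ∀ k z → natᶜ (suc k) ⊠ z ≃ᶜ z ⊞ natᶜ k ⊠ z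
natᶜ-suc-⊠ k z = begin
  natᶜ (suc k) ⊠ z            ≈⟨ ⊠-cong (fromℕ-suc k , ≃-refl) ≃ᶜ-refl ⟩
  real (1ᴿ + fromℕ k) ⊠ z     ≈⟨ ⊠-cong (real-+ 1ᴿ (fromℕ k)) ≃ᶜ-refl ⟩
  (1ᶜ ⊞ natᶜ k) ⊠ z           ≈⟨ ℂ-Ring.distribʳ z 1ᶜ (natᶜ k) ⟩
  1ᶜ ⊠ z ⊞ natᶜ k ⊠ z         ≈⟨ ⊞-cong (⊠-identityˡ z) ≃ᶜ-refl ⟩
  z ⊞ natᶜ k ⊠ z              ∎
  where open ≃ᶜ-Reasoning

Σ-const : ∀ n z → Σᶜ {n} (λ _ → z) ≃ᶜ natᶜ n ⊠ z
Σ-const zero    z = ≃ᶜ-sym (ℂ-Ring.zeroˡ z)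
Σ-const (suc n) z = ≃ᶜ-trans (⊞-cong ≃ᶜ-refl (Σ-const n z)) (≃ᶜ-sym (natᶜ-suc-⊠ n z))

Σ-indicator : ∀ {n} (A : Subset n) z →
              Σᶜ (λ i → if lookup A i then z else 0ᶜ) ≃ᶜ natᶜ ∣ A ∣ ⊠ z
Σ-indicator []            z = ≃ᶜ-sym (ℂ-Ring.zeroˡ z)
Σ-indicator (inside ∷ A)  z = ≃ᶜ-trans (⊞-cong ≃ᶜ-refl (Σ-indicator A z)) (≃ᶜ-sym (natᶜ-suc-⊠ ∣ A ∣ z))
Σ-indicator (outside ∷ A) z = ≃ᶜ-trans (⊞-identityˡ _) (Σ-indicator A z)

-- Characters

module CharacterTheory {c ℓ} (H : AbelianGroup c ℓ) {n : ℕ} (order : HasOrder H n) where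
  open AbelianGroup H using (Carrier; _≈_; _∙_; ε; _⁻¹)
  module H = AbelianGroup H
  open Inverse order using (to; from; to-cong; strictlyInverseˡ; strictlyInverseʳ)
  open ≃ᶜ-Reasoning

  translation : Carrier → Permutation′ n
  translation h = permutation
    (λ i → to (from i ∙ h)) (λ i → to (from i ∙ h ⁻¹))
    (λ i → trans (to-cong (H.trans (H.∙-congʳ (strictlyInverseʳ (from i ∙ h ⁻¹)))
      (H.trans (H.assoc (from i) (h ⁻¹) h)
      (H.trans (H.∙-congˡ (H.inverseˡ h)) (H.identityʳ (from i)))))) (strictlyInverseˡ i))
    (λ i → trans (to-cong (H.trans (H.∙-congʳ (strictlyInverseʳ (from i ∙ h)))
      (H.trans (H.assoc (from i) h (h ⁻¹))
      (H.trans (H.∙-congˡ (H.inverseʳ h)) (H.identityʳ (from i)))))) (strictlyInverseˡ i))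

  Σ-translate : ∀ (F : Carrier → ℂ) → (∀ {x y} → x ≈ y → F x ≃ᶜ F y) → ∀ h →
                Σᶜ (λ i → F (from i)) ≃ᶜ Σᶜ (λ i → F (from i ∙ h))
  Σ-translate F F-cong h = ≃ᶜ-trans (ℂ-Sum.sum-permute (F ∘ from) (translation h))
    (ℂ-Sum.sum-cong λ i → F-cong (strictlyInverseʳ (from i ∙ h)))

  module _ (χ : Character H) where
    open Character χ
    open IsMagmaHomomorphism isMagmaHomomorphism using (homo; ⟦⟧-cong)

    char-cong : ∀ {x y} → x ≈ y → ⟦ x ⟧ ≃ᶜ ⟦ y ⟧
    char-cong x≈y = ≈⇒≃ (⟦⟧-cong x≈y)

    char-homo : ∀ x y → ⟦ x ∙ y ⟧ ≃ᶜ ⟦ x ⟧ ⊠ ⟦ y ⟧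
    char-homo x y = ≃ᶜ-trans (≈⇒≃ (homo x y)) (ℂ-Ring.reflexive (sym (⊠-def ⟦ x ⟧ ⟦ y ⟧)))

    char-nonzero : ∀ h → ¬ ⟦ h ⟧ ≃ᶜ 0ᶜ
    char-nonzero h = nonzero h ∘ ≃⇒≈

    char-ε : ⟦ ε ⟧ ≃ᶜ 1ᶜ
    char-ε = ⊠-fixed⇒≃1 (≃ᶜ-trans (≃ᶜ-sym (char-homo ε ε)) (char-cong (H.identityˡ ε))) (char-nonzero ε)

  open Character using (⟦_⟧)

  inner : Character H → Character H → ℂ
  inner χ ψ = Σᶜ (λ i → ⟦ χ ⟧ (from i) ⊠ conj (⟦ ψ ⟧ (from i)))

  -- The summand is itself multiplicative in the group element. Shifting by `h` therefore multiplies
  -- the sum by the value at `h`, while reindexing shows that it does not change.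
  inner-translate : ∀ χ ψ h → (⟦ χ ⟧ h ⊠ conj (⟦ ψ ⟧ h)) ⊠ inner χ ψ ≃ᶜ inner χ ψ
  inner-translate χ ψ h = begin
    a ⊠ inner χ ψ                                    ≈⟨ ℂ-Sum.*-distribˡ-sum a (F ∘ from) ⟩
    Σᶜ (λ i → a ⊠ F (from i))                        ≈⟨ ℂ-Sum.sum-cong (λ i → F-homo (from i)) ⟨
    Σᶜ (λ i → F (from i ∙ h))                        ≈⟨ Σ-translate F F-cong h ⟨
    inner χ ψ                                        ∎
    where
    F : Carrier → ℂ
    F x = ⟦ χ ⟧ x ⊠ conj (⟦ ψ ⟧ x)
    a : ℂ
    a = F h
    F-cong : ∀ {x y} → x ≈ y → F x ≃ᶜ F y
    F-cong x≈y = ⊠-cong (char-cong χ x≈y) (conj-cong (char-cong ψ x≈y))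
    F-homo : ∀ x → F (x ∙ h) ≃ᶜ a ⊠ F x
    F-homo x = begin
      ⟦ χ ⟧ (x ∙ h) ⊠ conj (⟦ ψ ⟧ (x ∙ h))
        ≈⟨ ⊠-cong (char-homo χ x h) (≃ᶜ-trans (conj-cong (char-homo ψ x h)) (conj-⊠ _ _)) ⟩
      (⟦ χ ⟧ x ⊠ ⟦ χ ⟧ h) ⊠ (conj (⟦ ψ ⟧ x) ⊠ conj (⟦ ψ ⟧ h))
        ≈⟨ ⊠-interchange (⟦ χ ⟧ x) (⟦ χ ⟧ h) (conj (⟦ ψ ⟧ x)) (conj (⟦ ψ ⟧ h)) ⟩
      F x ⊠ a
        ≈⟨ ⊠-comm (F x) a ⟩
      a ⊠ F x ∎
      where open CommutativeSemigroupProperties ℂ-Ring.*-commutativeSemigroup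
              using () renaming (interchange to ⊠-interchange)

  re-inner : ∀ χ → re (inner χ χ) ≃ᴿ Σᴿ (λ i → normSq (⟦ χ ⟧ (from i)))
  re-inner χ = ≃-trans
    (ℝ-Ring.reflexive (re-Σ {n} (λ i → ⟦ χ ⟧ (from i) ⊠ conj (⟦ χ ⟧ (from i)))))
    (ℝ-Sum.sum-cong λ i → re≃ (z⊠conj-z (⟦ χ ⟧ (from i))))

  -- The real part is a sum of squared moduli; if it vanished, so would the value of χ at `ε`.
  inner-self≄0 : ∀ χ → ¬ inner χ χ ≃ᶜ 0ᶜ
  inner-self≄0 χ inner≃0 = char-nonzero χ (from (to ε))
    (normSq≃0⇒≃0 (Σ≃0⇒term≃0 (λ i → 0≤normSq (⟦ χ ⟧ (from i)))
      (≃-trans (≃-sym (re-inner χ)) (re≃ inner≃0)) (to ε)))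

  -- Translation invariance of the nonzero number `inner χ χ` replaces the usual argument that the
  -- values of a character are roots of unity.
  char-unitary : ∀ χ h → ⟦ χ ⟧ h ⊠ conj (⟦ χ ⟧ h) ≃ᶜ 1ᶜ
  char-unitary χ h = ⊠-fixed⇒≃1 (inner-translate χ χ h) (inner-self≄0 χ)

  inner-self : ∀ χ → inner χ χ ≃ᶜ natᶜ n
  inner-self χ = begin
    inner χ χ            ≈⟨ ℂ-Sum.sum-cong (λ i → char-unitary χ (from i)) ⟩
    Σᶜ {n} (λ _ → 1ᶜ)    ≈⟨ Σ-const n 1ᶜ ⟩
    natᶜ n ⊠ 1ᶜ          ≈⟨ ℂ-Ring.*-identityʳ (natᶜ n) ⟩
    natᶜ n               ∎

  -- If inner χ ψ were nonzero, translation invariance would force χ h ⊠ conj (ψ h) ≃ 1 for all h.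
  inner-distinct : ∀ χ ψ → ¬ χ ≈ˣ ψ → inner χ ψ ≃ᶜ 0ᶜ
  inner-distinct χ ψ χ≉ψ = stable-≃ᶜ0 λ inner≄0 → χ≉ψ λ h → ≃⇒≈ (begin
    ⟦ χ ⟧ h                                       ≈⟨ ℂ-Ring.*-identityʳ _ ⟨
    ⟦ χ ⟧ h ⊠ 1ᶜ                                  ≈⟨ ⊠-cong ≃ᶜ-refl (char-unitary ψ h) ⟨
    ⟦ χ ⟧ h ⊠ (⟦ ψ ⟧ h ⊠ conj (⟦ ψ ⟧ h))          ≈⟨ ⊠-cong ≃ᶜ-refl (⊠-comm _ _) ⟩
    ⟦ χ ⟧ h ⊠ (conj (⟦ ψ ⟧ h) ⊠ ⟦ ψ ⟧ h)          ≈⟨ ⊠-assoc _ _ _ ⟨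
    (⟦ χ ⟧ h ⊠ conj (⟦ ψ ⟧ h)) ⊠ ⟦ ψ ⟧ h          ≈⟨ ⊠-cong (⊠-fixed⇒≃1 (inner-translate χ ψ h) inner≄0) ≃ᶜ-refl ⟩
    1ᶜ ⊠ ⟦ ψ ⟧ h                                  ≈⟨ ⊠-identityˡ _ ⟩
    ⟦ ψ ⟧ h                                       ∎)

  conj-char : ∀ χ h → conj (⟦ χ ⟧ h) ≃ᶜ ⟦ χ ⟧ (h ⁻¹)
  conj-char χ h = begin
    conj (⟦ χ ⟧ h)                                    ≈⟨ ⊠-identityˡ _ ⟨
    1ᶜ ⊠ conj (⟦ χ ⟧ h)                               ≈⟨ ⊠-cong 1≃ ≃ᶜ-refl ⟩
    (⟦ χ ⟧ (h ⁻¹) ⊠ ⟦ χ ⟧ h) ⊠ conj (⟦ χ ⟧ h)         ≈⟨ ⊠-assoc _ _ _ ⟩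
    ⟦ χ ⟧ (h ⁻¹) ⊠ (⟦ χ ⟧ h ⊠ conj (⟦ χ ⟧ h))         ≈⟨ ⊠-cong ≃ᶜ-refl (char-unitary χ h) ⟩
    ⟦ χ ⟧ (h ⁻¹) ⊠ 1ᶜ                                 ≈⟨ ℂ-Ring.*-identityʳ _ ⟩
    ⟦ χ ⟧ (h ⁻¹)                                      ∎
    where
    1≃ : 1ᶜ ≃ᶜ ⟦ χ ⟧ (h ⁻¹) ⊠ ⟦ χ ⟧ h
    1≃ = ≃ᶜ-sym (≃ᶜ-trans (≃ᶜ-sym (char-homo χ (h ⁻¹) h))
      (≃ᶜ-trans (char-cong χ (H.inverseˡ h)) (char-ε χ)))

  -- The Fourier coefficient, unnormalised and without conjugation, of the indicator function of
  -- `A`. It is `charSum` written with the opaque addition.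
  transform : Character H → Subset n → ℂ
  transform χ A = Σᶜ (λ g → if lookup A g then ⟦ χ ⟧ (from g) else 0ᶜ)

-- The booleans stand for memberships: sums over a subset run over all indices with 0 outside it, so
-- a product with an index outside its set vanishes for every character.
Σ-gated₂≃0 : ∀ {n} b₁ b₂ (u v : Fin n → ℂ) →
  (b₁ ≡ true → b₂ ≡ true → Σᶜ (λ i → u i ⊠ conj (v i)) ≃ᶜ 0ᶜ) →
  Σᶜ (λ i → (if b₁ then u i else 0ᶜ) ⊠ conj (if b₂ then v i else 0ᶜ)) ≃ᶜ 0ᶜ
Σ-gated₂≃0 true  true  u v h = h refl refl
Σ-gated₂≃0 true  false u v h = ℂ-Sum.sum-zero λ i →
  ≃ᶜ-trans (⊠-cong ≃ᶜ-refl (conj-real 0ᴿ)) (ℂ-Ring.zeroʳ (u i))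
Σ-gated₂≃0 false b₂    u v h = ℂ-Sum.sum-zero λ i → ℂ-Ring.zeroˡ (conj (if b₂ then v i else 0ᶜ))

Σ-gated₃≃0 : ∀ {n} b₁ b₂ b₃ (u v w : Fin n → ℂ) →
  (b₁ ≡ true → b₂ ≡ true → b₃ ≡ true → Σᶜ (λ i → u i ⊠ v i ⊠ conj (w i)) ≃ᶜ 0ᶜ) →
  Σᶜ (λ i → (if b₁ then u i else 0ᶜ) ⊠ (if b₂ then v i else 0ᶜ) ⊠ conj (if b₃ then w i else 0ᶜ)) ≃ᶜ 0ᶜ
Σ-gated₃≃0 true  true  b₃ u v w h = Σ-gated₂≃0 true b₃ (λ i → u i ⊠ v i) w (λ _ → h refl refl)
Σ-gated₃≃0 true  false b₃ u v w h = ℂ-Sum.sum-zero λ i →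
  ≃ᶜ-trans (⊠-cong (ℂ-Ring.zeroʳ (u i)) ≃ᶜ-refl) (ℂ-Ring.zeroˡ (conj (if b₃ then w i else 0ᶜ)))
Σ-gated₃≃0 false b₂    b₃ u v w h = ℂ-Sum.sum-zero λ i →
  ≃ᶜ-trans (⊠-cong (ℂ-Ring.zeroˡ (if b₂ then v i else 0ᶜ)) ≃ᶜ-refl) (ℂ-Ring.zeroˡ (conj (if b₃ then w i else 0ᶜ)))

-- Column orthogonality, Parseval's identity and the triple correlation

module CharacterTable {c ℓ} (H : AbelianGroup c ℓ) {n : ℕ} (order : HasOrder H n)
  (χ : Fin n → Character H) (distinct : ∀ {i j} → χ i ≈ˣ χ j → i ≡ j) where
  open CharacterTheory H order
  open AbelianGroup H using (Carrier; _≈_; _≉_; _∙_; ε; _⁻¹; _-_)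
  module H′ = AbelianGroup H
  open GroupProperties H′.group using (x∙y⁻¹≈ε⇒x≈y)
  open Inverse order using (to; from; to-cong; from-cong; strictlyInverseˡ; strictlyInverseʳ)
  open Character using (⟦_⟧)
  open ≃ᶜ-Reasoning

  column : Carrier → ℂ
  column h = Σᶜ (λ i → ⟦ χ i ⟧ h)

  column-cong : ∀ {x y} → x ≈ y → column x ≃ᶜ column y
  column-cong x≈y = ℂ-Sum.sum-cong λ i → char-cong (χ i) x≈y

  Σ-ones : ∀ {f : Fin n → ℂ} → (∀ i → f i ≃ᶜ 1ᶜ) → Σᶜ f ≃ᶜ natᶜ n
  Σ-ones {f} f≃1 = begin
    Σᶜ f                 ≈⟨ ℂ-Sum.sum-cong f≃1 ⟩
    Σᶜ {n} (λ _ → 1ᶜ)    ≈⟨ Σ-const n 1ᶜ ⟩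
    natᶜ n ⊠ 1ᶜ          ≈⟨ ℂ-Ring.*-identityʳ (natᶜ n) ⟩
    natᶜ n               ∎

  column-ε : column ε ≃ᶜ natᶜ n
  column-ε = Σ-ones λ i → char-ε (χ i)

  -- With the sum over the group innermost, the terms are inner products of characters. Only the
  -- diagonal survives, and its `n` entries equal `n` each: the number of characters enters here.
  Σ-column² : Σᶜ (λ g → column (from g) ⊠ conj (column (from g))) ≃ᶜ natᶜ n ⊠ natᶜ n
  Σ-column² = begin
    Σᶜ (λ g → column (from g) ⊠ conj (column (from g)))
      ≈⟨ ℂ-Sum.sum-cong (λ g → ≃ᶜ-trans
           (⊠-cong ≃ᶜ-refl (conj-Σ (λ i → ⟦ χ i ⟧ (from g))))
           (ℂ-Sum.sum-⊗-sum (λ i → ⟦ χ i ⟧ (from g)) (λ j → conj (⟦ χ j ⟧ (from g))))) ⟩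
    Σᶜ (λ g → Σᶜ (λ i → Σᶜ (λ j → t g i j)))
      ≈⟨ ℂ-Sum.∑-comm (λ g i → Σᶜ (λ j → t g i j)) ⟩
    Σᶜ (λ i → Σᶜ (λ g → Σᶜ (λ j → t g i j)))
      ≈⟨ ℂ-Sum.sum-cong (λ i → ℂ-Sum.∑-comm (λ g j → t g i j)) ⟩
    Σᶜ (λ i → Σᶜ (λ j → inner (χ i) (χ j)))
      ≈⟨ ℂ-Sum.sum-cong (λ i → ≃ᶜ-trans
           (ℂ-Sum.sum-single i (λ j j≢i → inner-distinct (χ i) (χ j) (λ χᵢ≈χⱼ → j≢i (sym (distinct {i} {j} χᵢ≈χⱼ)))))
           (inner-self (χ i))) ⟩
    Σᶜ {n} (λ _ → natᶜ n)
      ≈⟨ Σ-const n (natᶜ n) ⟩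
    natᶜ n ⊠ natᶜ n ∎
    where
    t : Fin n → Fin n → Fin n → ℂ
    t g i j = ⟦ χ i ⟧ (from g) ⊠ conj (⟦ χ j ⟧ (from g))

  -- The term of ε alone accounts for the whole sum Σ-column².
  Σ-normSq-column : Σᴿ (λ g → normSq (column (from g))) ≃ᴿ normSq (column (from (to ε)))
  Σ-normSq-column = re≃ (≃ᶜ-sym (begin
    real (normSq (column (from (to ε))))
      ≈⟨ z⊠conj-z (column (from (to ε))) ⟨
    column (from (to ε)) ⊠ conj (column (from (to ε)))
      ≈⟨ ⊠-cong at-ε (≃ᶜ-trans (conj-cong at-ε) (conj-real (fromℕ n))) ⟩
    natᶜ n ⊠ natᶜ n
      ≈⟨ Σ-column² ⟨
    Σᶜ (λ g → column (from g) ⊠ conj (column (from g)))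
      ≈⟨ ℂ-Sum.sum-cong (λ g → z⊠conj-z (column (from g))) ⟩
    Σᶜ (λ g → real (normSq (column (from g))))
      ≈⟨ Σ-real (λ g → normSq (column (from g))) ⟩
    real (Σᴿ (λ g → normSq (column (from g)))) ∎))
    where
    at-ε : column (from (to ε)) ≃ᶜ natᶜ n
    at-ε = ≃ᶜ-trans (column-cong (strictlyInverseʳ ε)) column-ε

  column-zero : ∀ h → h ≉ ε → column h ≃ᶜ 0ᶜ
  column-zero h h≉ε = ≃ᶜ-trans (column-cong (H′.sym (strictlyInverseʳ h)))
    (normSq≃0⇒≃0 (Σ≃term⇒others≃0 (λ g → 0≤normSq (column (from g))) Σ-normSq-column
      (λ to-h≡to-ε → h≉ε (H′.trans (H′.sym (strictlyInverseʳ h))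
        (H′.trans (from-cong to-h≡to-ε) (strictlyInverseʳ ε))))))

  -- Conjugation is inversion of the argument, so this is the column sum at the quotient of two
  -- distinct elements.
  Σ-pair : ∀ g h → g ≢ h → Σᶜ (λ i → ⟦ χ i ⟧ (from g) ⊠ conj (⟦ χ i ⟧ (from h))) ≃ᶜ 0ᶜ
  Σ-pair g h g≢h = ≃ᶜ-trans
    (ℂ-Sum.sum-cong λ i → ≃ᶜ-trans (⊠-cong ≃ᶜ-refl (conj-char (χ i) (from h)))
      (≃ᶜ-sym (char-homo (χ i) (from g) (from h ⁻¹))))
    (column-zero (from g ∙ from h ⁻¹) λ eq → g≢h
      (trans (sym (strictlyInverseˡ g))
        (trans (to-cong (x∙y⁻¹≈ε⇒x≈y (from g) (from h) eq)) (strictlyInverseˡ h))))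

  -- After expansion, summing over the characters first leaves only the pairs with both elements
  -- equal, and each member of `A` contributes `n` since its character values have modulus 1.
  Σ-transform² : ∀ A → Σᶜ (λ i → transform (χ i) A ⊠ conj (transform (χ i) A)) ≃ᶜ natᶜ ∣ A ∣ ⊠ natᶜ n
  Σ-transform² A = begin
    Σᶜ (λ i → transform (χ i) A ⊠ conj (transform (χ i) A))
      ≈⟨ ℂ-Sum.sum-cong (λ i → ≃ᶜ-trans (⊠-cong ≃ᶜ-refl (conj-Σ (a i)))
           (ℂ-Sum.sum-⊗-sum (a i) (λ h → conj (a i h)))) ⟩
    Σᶜ (λ i → Σᶜ (λ g → Σᶜ (λ h → a i g ⊠ conj (a i h))))
      ≈⟨ ℂ-Sum.∑-comm (λ i g → Σᶜ (λ h → a i g ⊠ conj (a i h))) ⟩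
    Σᶜ (λ g → Σᶜ (λ i → Σᶜ (λ h → a i g ⊠ conj (a i h))))
      ≈⟨ ℂ-Sum.sum-cong (λ g → ℂ-Sum.∑-comm (λ i h → a i g ⊠ conj (a i h))) ⟩
    Σᶜ (λ g → Σᶜ (λ h → Σᶜ (λ i → a i g ⊠ conj (a i h))))
      ≈⟨ ℂ-Sum.sum-cong (λ g → ≃ᶜ-trans (ℂ-Sum.sum-single g (off-diagonal g)) (diagonal g (lookup A g))) ⟩
    Σᶜ (λ g → if lookup A g then natᶜ n else 0ᶜ)
      ≈⟨ Σ-indicator A (natᶜ n) ⟩
    natᶜ ∣ A ∣ ⊠ natᶜ n ∎
    where
    a : Fin n → Fin n → ℂ
    a i g = if lookup A g then ⟦ χ i ⟧ (from g) else 0ᶜ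
    off-diagonal : ∀ g h → h ≢ g → Σᶜ (λ i → a i g ⊠ conj (a i h)) ≃ᶜ 0ᶜ
    off-diagonal g h h≢g = Σ-gated₂≃0 (lookup A g) (lookup A h)
      (λ i → ⟦ χ i ⟧ (from g)) (λ i → ⟦ χ i ⟧ (from h)) (λ _ _ → Σ-pair g h (h≢g ∘ sym))
    diagonal : ∀ g b → Σᶜ (λ i → (if b then ⟦ χ i ⟧ (from g) else 0ᶜ) ⊠
                                 conj (if b then ⟦ χ i ⟧ (from g) else 0ᶜ))
                       ≃ᶜ (if b then natᶜ n else 0ᶜ)
    diagonal g true  = Σ-ones λ i → char-unitary (χ i) (from g)
    diagonal g false = ℂ-Sum.sum-zero {n} {λ _ → 0ᶜ ⊠ conj 0ᶜ} λ i → ℂ-Ring.zeroˡ (conj 0ᶜ)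

  -- This is the column sum at s + x - y, which is the unit exactly when y - x = s, that is when `s`
  -- labels an edge from x to y.
  Σ-triple : ∀ s x y → ¬ (from y - from x ≈ from s) →
    Σᶜ (λ i → ⟦ χ i ⟧ (from s) ⊠ ⟦ χ i ⟧ (from x) ⊠ conj (⟦ χ i ⟧ (from y))) ≃ᶜ 0ᶜ
  Σ-triple s x y y-x≉s = ≃ᶜ-trans
    (ℂ-Sum.sum-cong λ i → ≃ᶜ-trans
      (⊠-cong (≃ᶜ-sym (char-homo (χ i) (from s) (from x))) (conj-char (χ i) (from y)))
      (≃ᶜ-sym (char-homo (χ i) (from s ∙ from x) (from y ⁻¹))))
    (column-zero (from s ∙ from x ∙ from y ⁻¹) λ eq → y-x≉s
      (H′.trans (H′.∙-congʳ (H′.sym (x∙y⁻¹≈ε⇒x≈y (from s ∙ from x) (from y) eq)))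
      (H′.trans (H′.assoc (from s) (from x) (from x ⁻¹))
      (H′.trans (H′.∙-congˡ (H′.inverseʳ (from x))) (H′.identityʳ (from s))))))

  -- The sum counts the edges from `X` to `Y`, each with weight `n`; without edges every term of its
  -- expansion over s, x and y vanishes.
  Σ-transform-triple : ∀ S X Y →
    (∀ s x y → lookup S s ≡ true → lookup X x ≡ true → lookup Y y ≡ true → ¬ (from y - from x ≈ from s)) →
    Σᶜ (λ i → transform (χ i) S ⊠ transform (χ i) X ⊠ conj (transform (χ i) Y)) ≃ᶜ 0ᶜ
  Σ-transform-triple S X Y no-edge = begin
    Σᶜ (λ i → transform (χ i) S ⊠ transform (χ i) X ⊠ conj (transform (χ i) Y))
      ≈⟨ ℂ-Sum.sum-cong (λ i → ≃ᶜ-trans (⊠-cong ≃ᶜ-refl (conj-Σ (a Y i)))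
           (ℂ-Sum.sum-⊗-sum-⊗-sum (a S i) (a X i) (λ y → conj (a Y i y)))) ⟩
    Σᶜ (λ i → Σᶜ (λ s → Σᶜ (λ x → Σᶜ (λ y → t i s x y))))
      ≈⟨ ℂ-Sum.∑-comm (λ i s → Σᶜ (λ x → Σᶜ (λ y → t i s x y))) ⟩
    Σᶜ (λ s → Σᶜ (λ i → Σᶜ (λ x → Σᶜ (λ y → t i s x y))))
      ≈⟨ ℂ-Sum.sum-zero (λ s → ≃ᶜ-trans (ℂ-Sum.∑-comm (λ i x → Σᶜ (λ y → t i s x y)))
           (ℂ-Sum.sum-zero (λ x → ≃ᶜ-trans (ℂ-Sum.∑-comm (λ i y → t i s x y))
             (ℂ-Sum.sum-zero (λ y → Σ-gated₃≃0 (lookup S s) (lookup X x) (lookup Y y)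
               (λ i → ⟦ χ i ⟧ (from s)) (λ i → ⟦ χ i ⟧ (from x)) (λ i → ⟦ χ i ⟧ (from y))
               (λ s∈S x∈X y∈Y → Σ-triple s x y (no-edge s x y s∈S x∈X y∈Y))))))) ⟩
    0ᶜ ∎
    where
    a : Subset n → Fin n → Fin n → ℂ
    a A i g = if lookup A g then ⟦ χ i ⟧ (from g) else 0ᶜ
    t : Fin n → Fin n → Fin n → Fin n → ℂ
    t i s x y = a S i s ⊠ a X i x ⊠ conj (a Y i y)

-- The spectral bound

fold-⊔-upper : ∀ {n} (f : Fin n → ℝ) i → f i ≤ᴿ Vector.foldr _⊔ᴿ_ 0ᴿ f
fold-⊔-upper {suc n} f zero    = pointwise-≤ λ k → ℚ.p≤p⊔q (seq (f zero) k) _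
fold-⊔-upper {suc n} f (suc i) = ≤-trans (fold-⊔-upper (f ∘ suc) i)
  (pointwise-≤ λ k → ℚ.p≤q⊔p (seq (f zero) k) _)

0≤fold-⊔ : ∀ {n} (f : Fin n → ℝ) → 0ᴿ ≤ᴿ Vector.foldr _⊔ᴿ_ 0ᴿ f
0≤fold-⊔ {zero}  f = ≤-refl
0≤fold-⊔ {suc n} f = ≤-trans (0≤fold-⊔ (f ∘ suc)) (pointwise-≤ λ k → ℚ.p≤q⊔p (seq (f zero) k) _)

∣∣ᶜ-def : ∀ z → ∣ z ∣ᶜ ≡ √ (re z *ᴿ re z +ᴿ im z *ᴿ im z)
∣∣ᶜ-def z = refl

∣z∣≡sqrt : ∀ {z w} → z ≡ w → ∣ z ∣ᶜ ≡ sqrt (normSq w)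
∣z∣≡sqrt {z} refl = trans (∣∣ᶜ-def z) (trans (sym (sqrt-def (re z *ᴿ re z +ᴿ im z *ᴿ im z)))
  (cong sqrt (sym (normSq-def z))))

-- Both `charSum` and `maxCharSum` are folds. Rewriting them to the opaque operations by
-- propositional equality, rather than up to `_≃ᴿ_`, lets `cong` pass under the square root without
-- any continuity argument.
foldr-cong : ∀ {A : Set} {_∙_ _∘′_ : A → A → A} {e} → (∀ x y → x ∙ y ≡ x ∘′ y) →
             ∀ {n} {f g : Fin n → A} → (∀ i → f i ≡ g i) →
             Vector.foldr _∙_ e f ≡ Vector.foldr _∘′_ e g
foldr-cong                   ∙≡∘ {zero}          f≡g = refl
foldr-cong {_∘′_ = _∘′_} {e} ∙≡∘ {suc n} {f} {g} f≡g =
  trans (∙≡∘ (f zero) _) (cong₂ _∘′_ (f≡g zero) (foldr-cong ∙≡∘ {n} {f ∘ suc} {g ∘ suc} (f≡g ∘ suc)))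

foldr-⊔-cong : ∀ {n} (f g : Fin n → ℝ) → (∀ i → f i ≡ g i) →
               Vector.foldr _⊔ᴿ_ 0ᴿ f ≡ Vector.foldr _⊔ᴿ_ 0ᴿ g
foldr-⊔-cong f g = foldr-cong {_∙_ = _⊔ᴿ_} {_⊔ᴿ_} {0ᴿ} (λ _ _ → refl) {f = f} {g}

module _ {c ℓ} (H : AbelianGroup c ℓ) {n : ℕ} (order : HasOrder H n) where
  open CharacterTheory H order using (transform)

  charSum≡transform : ∀ χ A → Cayley.charSum H order χ A ≡ transform χ A
  charSum≡transform χ A = foldr-cong {_∙_ = _+ᶜ_} {_⊞_} {0ᶜ} (λ z w → sym (⊞-def z w))
    {f = λ g → if lookup A g then Character.⟦_⟧ χ (Inverse.from order g) else 0ᶜ} λ _ → refl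

module _ {c ℓ} (H : AbelianGroup c ℓ) {m : ℕ} (order : HasOrder H (suc m))
  (χ : Fin (suc m) → Character H) (S : Subset (suc m)) where
  maxTransform : ℝ
  maxTransform = Vector.foldr _⊔ᴿ_ 0ᴿ (λ i → sqrt (normSq (CharacterTheory.transform H order (χ (suc i)) S)))

  maxCharSum≡ : maxCharSum H order χ S ≡ maxTransform
  maxCharSum≡ = foldr-⊔-cong
    (λ i → ∣ Cayley.charSum H order (χ (suc i)) S ∣ᶜ)
    (λ i → sqrt (normSq (CharacterTheory.transform H order (χ (suc i)) S)))
    (λ i → ∣z∣≡sqrt {Cayley.charSum H order (χ (suc i)) S} {CharacterTheory.transform H order (χ (suc i)) S}
      (charSum≡transform H order (χ (suc i)) S))

  opaque
    unfolding _*_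

    n⋆≃ : .{{_ : ℕ.NonZero ∣ S ∣}} → n⋆ H order χ S ≃ᴿ fromℚ (+ suc m ℚ./ ∣ S ∣) * maxTransform
    n⋆≃ = pointwise λ k → cong (λ M → (+ suc m ℚ./ ∣ S ∣) ℚ.* seq M k) maxCharSum≡

-- Inequalities and identities for the weighted sum

real-* : ∀ x y → real x ⊠ real y ≃ᶜ real (x * y)
real-* x y = ≃ᶜ-trans (real-⊠ x (real y)) (≃-refl , ℝ-Ring.zeroʳ x)

Σ-linear : ∀ {n} A B C (f g h : Fin n → ℝ) →
  Σᴿ (λ i → A * f i + B * g i + C * h i) ≃ᴿ A * Σᴿ f + B * Σᴿ g + C * Σᴿ h
Σ-linear A B C f g h = begin
  Σᴿ (λ i → A * f i + B * g i + C * h i)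
    ≈⟨ ℝ-Sum.∑-distrib-+ (λ i → A * f i + B * g i) (λ i → C * h i) ⟩
  Σᴿ (λ i → A * f i + B * g i) + Σᴿ (λ i → C * h i)
    ≈⟨ +-cong (ℝ-Sum.∑-distrib-+ (λ i → A * f i) (λ i → B * g i)) (≃-sym (ℝ-Sum.*-distribˡ-sum C h)) ⟩
  Σᴿ (λ i → A * f i) + Σᴿ (λ i → B * g i) + C * Σᴿ h
    ≈⟨ +-cong (+-cong (ℝ-Sum.*-distribˡ-sum A f) (ℝ-Sum.*-distribˡ-sum B g)) ≃-refl ⟨
  A * Σᴿ f + B * Σᴿ g + C * Σᴿ h ∎
  where open ≃-Reasoning

x≤y+x : ∀ {x y} → 0ᴿ ≤ᴿ y → x ≤ᴿ y + x
x≤y+x {x} 0≤y = ≤-trans (≃⇒≥ (+-identityˡ x)) (+-mono-≤ 0≤y ≤-refl)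

+-cancelʳ-≤ : ∀ {x y} z → x + z ≤ᴿ y + z → x ≤ᴿ y
+-cancelʳ-≤ {x} {y} z h = ≤-trans (≃⇒≥ (x+z-z x)) (≤-trans (+-mono-≤ h ≤-refl) (≃⇒≤ (x+z-z y)))
  where
  x+z-z : ∀ x → x + z + - z ≃ᴿ x
  x+z-z x = ≃-trans (+-assoc x z (- z)) (≃-trans (+-cong ≃-refl (+-inverseʳ z)) (+-identityʳ x))

1≤x*y : ∀ {x y} → 1ᴿ ≤ᴿ x → 1ᴿ ≤ᴿ y → 1ᴿ ≤ᴿ x * y
1≤x*y {x} {y} 1≤x 1≤y = ≤-trans (≃⇒≥ (*-identityˡ 1ᴿ))
  (*-mono 0≤1 (≤-trans 0≤1 1≤y) 1≤x 1≤y)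

opaque
  unfolding _+_

  [x+y]² : ∀ x y → (x + y) * (x + y) ≃ᴿ (x * y + x * y) + (x * x + y * y)
  [x+y]² x y = pointwise λ n → solve 2 (λ x y →
    (x :+ y) :* (x :+ y) := (x :* y :+ x :* y) :+ (x :* x :+ y :* y)) refl (seq x n) (seq y n)

  -- With α = N b and β = s a b, this and the next three identities bring the weighted bound to a
  -- common coefficient c. The cross term yields c a b twice, and one copy cancels against the
  -- second square.
  double-product : ∀ N s a b → (1ᴿ + 1ᴿ) * (N * b * (s * (a * b))) * (s * a * b) ≃ᴿ
    N * s * s * b * (a * b) * (a * b) + N * s * s * b * (a * b) * (a * b)
  double-product N s a b = pointwise λ n → solve 4 (λ N s a b →
    (con 1ℚ :+ con 1ℚ) :* (N :* b :* (s :* (a :* b))) :* (s :* a :* b) :=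
    N :* s :* s :* b :* (a :* b) :* (a :* b) :+ N :* s :* s :* b :* (a :* b) :* (a :* b)) refl
    (seq N n) (seq s n) (seq a n) (seq b n)

  first-square : ∀ N a b M → N * b * (N * b) * (M * M) * (a * N) ≃ᴿ N * b * (a * b) * ((N * M) * (N * M))
  first-square N a b M = pointwise λ n → solve 4 (λ N a b M →
    N :* b :* (N :* b) :* (M :* M) :* (a :* N) := N :* b :* (a :* b) :* ((N :* M) :* (N :* M))) refl
    (seq N n) (seq a n) (seq b n) (seq M n)

  first-square′ : ∀ N s a b ν → N * b * (a * b) * ((s * ν) * (s * ν)) ≃ᴿ N * s * s * b * (a * b) * (ν * ν)
  first-square′ N s a b ν = pointwise λ n → solve 5 (λ N s a b ν →
    N :* b :* (a :* b) :* ((s :* ν) :* (s :* ν)) := N :* s :* s :* b :* (a :* b) :* (ν :* ν)) refl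
    (seq N n) (seq s n) (seq a n) (seq b n) (seq ν n)

  second-square : ∀ N s a b → s * (a * b) * (s * (a * b)) * (b * N) ≃ᴿ N * s * s * b * (a * b) * (a * b)
  second-square N s a b = pointwise λ n → solve 4 (λ N s a b →
    s :* (a :* b) :* (s :* (a :* b)) :* (b :* N) := N :* s :* s :* b :* (a :* b) :* (a :* b)) refl
    (seq N n) (seq s n) (seq a n) (seq b n)

<ᴿ⇒≪ : ∀ {x x′ y y′} → x ≃ᴿ x′ → y ≃ᴿ y′ → x <ᴿ y → x′ ≪ y′
<ᴿ⇒≪ {x} {x′} x≃x′ y≃y′ x<y with <ᴿ⇒gap x<y
... | ε , 0<ε , x+ε≤y = ε , 0<ε , ≤-trans (≃⇒≥ (+-cong x≃x′ ≃-refl)) (≤-trans x+ε≤y (≃⇒≤ y≃y′))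

-- From y ≥ x + ε ≥ 0 follows y² ≥ x² + ε², so the refuted inequality would give c ε² ≤ 0. As c ≥ 1,
-- already ε² ≤ 0, which is absurd between rationals; no division by c takes place.
x≪y⇒cy²≰cx² : ∀ {c x y} → 1ᴿ ≤ᴿ c → 0ᴿ ≤ᴿ x → x ≪ y → ¬ c * (y * y) ≤ᴿ c * (x * x)
x≪y⇒cy²≰cx² {c} {x} {y} 1≤c 0≤x (ε , 0<ε , x+ε≤y) cy²≤cx² =
  ℚ.<-irrefl refl (ℚ.<-≤-trans (0<* 0<ε 0<ε) (fromℚ-cancel-≤ (begin
    fromℚ (ε ℚ.* ε)   ≈⟨ fromℚ-* ε ε ⟨
    e * e             ≈⟨ *-identityˡ (e * e) ⟨
    1ᴿ * (e * e)      ≤⟨ *-mono 0≤1 (0≤x² e) 1≤c ≤-refl ⟩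
    c * (e * e)       ≤⟨ +-cancelʳ-≤ (c * (x * x)) ce²+cx²≤cx² ⟩
    0ᴿ                ∎)))
  where
  open ≤-Reasoning
  0≤c : 0ᴿ ≤ᴿ c
  0≤c = ≤-trans 0≤1 1≤c
  e : ℝ
  e = fromℚ ε
  0≤e : 0ᴿ ≤ᴿ e
  0≤e = fromℚ-mono-≤ (ℚ.<⇒≤ 0<ε)
  0≤x+e : 0ᴿ ≤ᴿ x + e
  0≤x+e = ≤-trans 0≤e (x≤y+x 0≤x)
  0≤xe : 0ᴿ ≤ᴿ x * e
  0≤xe = 0≤x*y 0≤x 0≤e
  ce²+cx²≤cx² : c * (e * e) + c * (x * x) ≤ᴿ 0ᴿ + c * (x * x)
  ce²+cx²≤cx² = begin
    c * (e * e) + c * (x * x)     ≈⟨ *-distribˡ-+ c (e * e) (x * x) ⟨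
    c * (e * e + x * x)           ≈⟨ *-cong ≃-refl (+-comm (e * e) (x * x)) ⟩
    c * (x * x + e * e)           ≤⟨ *-monoˡ-≤ c 0≤c (x≤y+x (≤-trans 0≤xe (x≤y+x 0≤xe))) ⟩
    c * ((x * e + x * e) + (x * x + e * e)) ≈⟨ *-cong ≃-refl ([x+y]² x e) ⟨
    c * ((x + e) * (x + e))       ≤⟨ *-monoˡ-≤ c 0≤c (*-mono 0≤x+e (≤-trans 0≤x+e x+ε≤y) x+ε≤y x+ε≤y) ⟩
    c * (y * y)                   ≤⟨ cy²≤cx² ⟩
    c * (x * x)                   ≈⟨ +-identityˡ (c * (x * x)) ⟨
    0ᴿ + c * (x * x)              ∎

-- Used to exclude empty vertex sets, for which y² = |X||Y| would be 0.
0≤x≪y⇒y²≄0 : ∀ {x y} → 0ᴿ ≤ᴿ x → x ≪ y → ¬ y * y ≃ᴿ 0ᴿ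
0≤x≪y⇒y²≄0 {x} {y} 0≤x x≪y y²≃0 = x≪y⇒cy²≰cx² ≤-refl 0≤x x≪y
  (*-monoˡ-≤ 1ᴿ 0≤1 (≤-trans (≃⇒≤ y²≃0) (0≤x² x)))

-- The bound for an edgeless pair and the resulting edge

module _ {h ℓ} (H : AbelianGroup h ℓ) {m : ℕ} (order : HasOrder H (suc m))
  (χ : Fin (suc m) → Character H) (distinct : ∀ {i j} → χ i ≈ˣ χ j → i ≡ j) (trivial : IsTrivial (χ zero))
  where
  open Inverse order using (to; from; to-cong; strictlyInverseˡ; strictlyInverseʳ)
  open AbelianGroup H using (_-_)
  open Cayley H order
  open CharacterTheory H order using (transform)
  open CharacterTable H order χ distinct
  open Character using (⟦_⟧)

  n : ℕ
  n = suc m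

  infix 4 _∈?_

  _∈?_ : ∀ h (A : Subset n) → Dec (h ∈ A)
  h ∈? A = to h Subset∈? A

  transform-trivial : ∀ A → transform (χ zero) A ≃ᶜ natᶜ ∣ A ∣
  transform-trivial A = begin
    transform (χ zero) A                            ≈⟨ ℂ-Sum.sum-cong (λ g → gate (lookup A g) g) ⟩
    Σᶜ (λ g → if lookup A g then 1ᶜ else 0ᶜ)        ≈⟨ Σ-indicator A 1ᶜ ⟩
    natᶜ ∣ A ∣ ⊠ 1ᶜ                                 ≈⟨ ℂ-Ring.*-identityʳ (natᶜ ∣ A ∣) ⟩
    natᶜ ∣ A ∣                                      ∎
    where
    open ≃ᶜ-Reasoning
    gate : ∀ b g → (if b then ⟦ χ zero ⟧ (from g) else 0ᶜ) ≃ᶜ (if b then 1ᶜ else 0ᶜ)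
    gate true  g = ≈⇒≃ (trivial (from g))
    gate false g = ≃ᶜ-refl

  -- Parseval's identity with the trivial term |A|² discarded; this is why the factor is n and not n
  -- - |A|.
  Σ-normSq-transform : ∀ A → Σᴿ (λ i → normSq (transform (χ (suc i)) A)) ≤ᴿ fromℕ ∣ A ∣ * fromℕ n
  Σ-normSq-transform A = ≤-trans (x≤y+x (0≤normSq (transform (χ zero) A))) (≃⇒≤ (re≃ (begin
    real (Σᴿ (λ i → normSq (transform (χ i) A)))              ≈⟨ Σ-real (λ i → normSq (transform (χ i) A)) ⟨
    Σᶜ (λ i → real (normSq (transform (χ i) A)))              ≈⟨ ℂ-Sum.sum-cong (λ i → z⊠conj-z (transform (χ i) A)) ⟨
    Σᶜ (λ i → transform (χ i) A ⊠ conj (transform (χ i) A))   ≈⟨ Σ-transform² A ⟩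
    natᶜ ∣ A ∣ ⊠ natᶜ n                                       ≈⟨ real-* (fromℕ ∣ A ∣) (fromℕ n) ⟩
    real (fromℕ ∣ A ∣ * fromℕ n)                              ∎)))
    where open ≃ᶜ-Reasoning

  module _ (S X Y : Subset n) where
    M N s a b : ℝ
    M = maxTransform H order χ S
    N = fromℕ n
    s = fromℕ ∣ S ∣
    a = fromℕ ∣ X ∣
    b = fromℕ ∣ Y ∣

    0≤M : 0ᴿ ≤ᴿ M
    0≤M = 0≤fold-⊔ (λ i → sqrt (normSq (transform (χ (suc i)) S)))

    normSq-transform≤M² : ∀ i → normSq (transform (χ (suc i)) S) ≤ᴿ M * M
    normSq-transform≤M² i = begin
      normSq (transform (χ (suc i)) S)   ≈⟨ sqrt*sqrt (0≤normSq (transform (χ (suc i)) S)) ⟨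
      d * d                              ≤⟨ *-mono (0≤sqrt (normSq (transform (χ (suc i)) S))) 0≤M d≤M d≤M ⟩
      M * M                              ∎
      where
      open ≤-Reasoning
      d : ℝ
      d = sqrt (normSq (transform (χ (suc i)) S))
      d≤M : d ≤ᴿ M
      d≤M = fold-⊔-upper (λ i → sqrt (normSq (transform (χ (suc i)) S))) i

    correlation : Fin n → ℂ
    correlation i = transform (χ i) S ⊠ transform (χ i) X ⊠ conj (transform (χ i) Y)

    re-correlation₀ : re (correlation zero) ≃ᴿ s * a * b
    re-correlation₀ = re≃ (begin
      correlation zero
        ≈⟨ ⊠-cong (⊠-cong (transform-trivial S) (transform-trivial X))
             (≃ᶜ-trans (conj-cong (transform-trivial Y)) (conj-real b)) ⟩
      real s ⊠ real a ⊠ real b    ≈⟨ ⊠-cong (real-* s a) ≃ᶜ-refl ⟩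
      real (s * a) ⊠ real b       ≈⟨ real-* (s * a) b ⟩
      real (s * a * b)            ∎)
      where open ≃ᶜ-Reasoning

    -- Summing 0 ≤ |α Ŝ X̂ + β Ŷ|² over the nontrivial characters.
    weighted-bound : ∀ α β → Σᶜ correlation ≃ᶜ 0ᶜ → 0ᴿ ≤ᴿ α * β →
      (1ᴿ + 1ᴿ) * (α * β) * (s * a * b) ≤ᴿ α * α * (M * M) * (a * N) + β * β * (b * N)
    weighted-bound α β Σ≃0 0≤αβ = begin
      B * (s * a * b)
        ≈⟨ +-identityˡ _ ⟨
      0ᴿ + B * (s * a * b)
        ≤⟨ +-mono-≤ (0≤Σ λ i → 0≤normSq (z i)) ≤-refl ⟩
      Σᴿ (λ i → normSq (z i)) + B * (s * a * b)
        ≤⟨ +-mono-≤ (Σ-mono bound) ≤-refl ⟩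
      Σᴿ (λ i → A * p i + B * c′ i + C * q i) + B * (s * a * b)
        ≈⟨ +-cong (Σ-linear A B C p c′ q) ≃-refl ⟩
      A * Σᴿ p + B * Σᴿ c′ + C * Σᴿ q + B * (s * a * b)
        ≈⟨ rearrange A B C (Σᴿ p) (Σᴿ c′) (Σᴿ q) (s * a * b) ⟩
      -- s a b is the trivial character's share, so the last bracket is the real part of the whole
      -- correlation sum.
      A * Σᴿ p + C * Σᴿ q + B * (s * a * b + Σᴿ c′)
        ≈⟨ +-cong ≃-refl (≃-trans (*-cong ≃-refl total≃0) (ℝ-Ring.zeroʳ B)) ⟩
      A * Σᴿ p + C * Σᴿ q + 0ᴿ
        ≈⟨ +-identityʳ _ ⟩
      A * Σᴿ p + C * Σᴿ q
        ≤⟨ +-mono-≤ (*-monoˡ-≤ A 0≤A (Σ-normSq-transform X)) (*-monoˡ-≤ C (0≤x² β) (Σ-normSq-transform Y)) ⟩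
      A * (a * N) + C * (b * N) ∎
      where
      open ≤-Reasoning
      A B C : ℝ
      A = α * α * (M * M)
      B = (1ᴿ + 1ᴿ) * (α * β)
      C = β * β
      0≤A : 0ᴿ ≤ᴿ A
      0≤A = 0≤x*y (0≤x² α) (0≤x² M)
      z : Fin m → ℂ
      z i = real α ⊠ (transform (χ (suc i)) S ⊠ transform (χ (suc i)) X) ⊞ real β ⊠ transform (χ (suc i)) Y
      p c′ q : Fin m → ℝ
      p i = normSq (transform (χ (suc i)) X)
      c′ i = re (correlation (suc i))
      q i = normSq (transform (χ (suc i)) Y)
      total≃0 : s * a * b + Σᴿ c′ ≃ᴿ 0ᴿ
      total≃0 = ≃-trans (+-cong (≃-sym re-correlation₀) ≃-refl)
        (≃-trans (ℝ-Ring.reflexive (sym (re-Σ correlation))) (re≃ Σ≃0))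
      bound : ∀ i → normSq (z i) ≤ᴿ A * p i + B * c′ i + C * q i
      bound i = begin
        normSq (z i)
          ≈⟨ normSq-combination α β (transform (χ (suc i)) S ⊠ transform (χ (suc i)) X) (transform (χ (suc i)) Y) ⟩
        α * α * normSq (transform (χ (suc i)) S ⊠ transform (χ (suc i)) X) + B * c′ i + C * q i
          ≤⟨ +-mono-≤ (+-mono-≤ (*-monoˡ-≤ (α * α) (0≤x² α) (begin
               normSq (transform (χ (suc i)) S ⊠ transform (χ (suc i)) X)
                 ≈⟨ normSq-⊠ (transform (χ (suc i)) S) (transform (χ (suc i)) X) ⟩
               normSq (transform (χ (suc i)) S) * p i
                 ≤⟨ *-mono (0≤normSq (transform (χ (suc i)) S)) (0≤normSq (transform (χ (suc i)) X))
                      (normSq-transform≤M² i) ≤-refl ⟩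
               M * M * p i ∎)) ≤-refl) ≤-refl ⟩
        α * α * (M * M * p i) + B * c′ i + C * q i
          ≈⟨ +-cong (+-cong (*-assoc (α * α) (M * M) (p i)) ≃-refl) ≃-refl ⟨
        A * p i + B * c′ i + C * q i ∎
      rearrange : ∀ A B C p c q k → A * p + B * c + C * q + B * k ≃ᴿ A * p + C * q + B * (k + c)
      rearrange A B C p c q k = ≃-trans (+-cong (xy∙z≈xz∙y (A * p) (B * c) (C * q)) ≃-refl)
        (≃-trans (+-assoc (A * p + C * q) (B * c) (B * k))
          (+-cong ≃-refl (≃-trans (+-comm (B * c) (B * k)) (≃-sym (*-distribˡ-+ B k c)))))
        where open CommutativeSemigroupProperties ℝ-Ring.+-commutativeSemigroup
                using (xy∙z≈xz∙y)

    module _ .{{∣S∣≢0 : ℕ.NonZero ∣ S ∣}} where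
      ν : ℝ
      ν = fromℚ (+ suc m ℚ./ ∣ S ∣) * M

      s*ν≃N*M : s * ν ≃ᴿ N * M
      s*ν≃N*M = ≃-trans (≃-sym (*-assoc s (fromℚ (+ suc m ℚ./ ∣ S ∣)) M)) (*-cong (fromℕ*fromℚ/ n ∣ S ∣) ≃-refl)

      0≤ν : 0ᴿ ≤ᴿ ν
      0≤ν = 0≤x*y (fromℚ-mono-≤ (ℚ.nonNegative⁻¹ (+ suc m ℚ./ ∣ S ∣) {{ℚ.normalize-nonNeg n ∣ S ∣}})) 0≤M

      -- The weights α = N b and β = s a b make both squares multiples of c = N s² b (a b).
      n⋆²-bound : Σᶜ correlation ≃ᶜ 0ᶜ →
        N * s * s * b * (a * b) * (a * b) ≤ᴿ N * s * s * b * (a * b) * (ν * ν)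
      n⋆²-bound Σ≃0 = +-cancelʳ-≤ (c * (a * b)) (begin
        c * (a * b) + c * (a * b)
          ≈⟨ double-product N s a b ⟨
        (1ᴿ + 1ᴿ) * (N * b * (s * (a * b))) * (s * a * b)
          ≤⟨ weighted-bound (N * b) (s * (a * b)) Σ≃0 0≤αβ ⟩
        N * b * (N * b) * (M * M) * (a * N) + s * (a * b) * (s * (a * b)) * (b * N)
          ≈⟨ +-cong (≃-trans (first-square N a b M)
               (≃-trans (*-cong ≃-refl (*-cong (≃-sym s*ν≃N*M) (≃-sym s*ν≃N*M))) (first-square′ N s a b ν)))
               (second-square N s a b) ⟩
        c * (ν * ν) + c * (a * b) ∎)
        where
        open ≤-Reasoning
        c : ℝ
        c = N * s * s * b * (a * b)
        0≤αβ : 0ᴿ ≤ᴿ N * b * (s * (a * b))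
        0≤αβ = 0≤x*y (0≤x*y (0≤fromℕ n) (0≤fromℕ ∣ Y ∣))
          (0≤x*y (0≤fromℕ ∣ S ∣) (0≤x*y (0≤fromℕ ∣ X ∣) (0≤fromℕ ∣ Y ∣)))

      -- Only the square of `r` matters, so `r` can be √(|X||Y|) or, for Y = X, the number |X|. If X
      -- or Y is empty, the common coefficient is 0 and the bound is void; but then r² = 0, against
      -- 0 ≤ `ν` ≪ `r`.
      correlation-obstructs : ∀ {r} → r * r ≃ᴿ a * b → ν ≪ r → ¬ Σᶜ correlation ≃ᶜ 0ᶜ
      correlation-obstructs {r} r²≃ab ν≪r Σ≃0 = cases (∣ X ∣ ℕ.≟ 0) (∣ Y ∣ ℕ.≟ 0)
        where
        ab≄0 : ¬ a * b ≃ᴿ 0ᴿ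
        ab≄0 ab≃0 = 0≤x≪y⇒y²≄0 0≤ν ν≪r (≃-trans r²≃ab ab≃0)
        1≤s : 1ᴿ ≤ᴿ s
        1≤s = 1≤fromℕ ∣ S ∣
        cases : Dec (∣ X ∣ ≡ 0) → Dec (∣ Y ∣ ≡ 0) → ⊥
        cases (yes ∣X∣≡0) _ =
          ab≄0 (≃-trans (*-cong (ℝ-Ring.reflexive (cong fromℕ ∣X∣≡0)) ≃-refl) (ℝ-Ring.zeroˡ b))
        cases (no _) (yes ∣Y∣≡0) =
          ab≄0 (≃-trans (*-cong ≃-refl (ℝ-Ring.reflexive (cong fromℕ ∣Y∣≡0))) (ℝ-Ring.zeroʳ a))
        cases (no ∣X∣≢0) (no ∣Y∣≢0) = x≪y⇒cy²≰cx² 1≤c 0≤ν ν≪r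
          (≤-trans (≃⇒≤ (*-cong ≃-refl r²≃ab)) (n⋆²-bound Σ≃0))
          where
          1≤a : 1ᴿ ≤ᴿ a
          1≤a = 1≤fromℕ ∣ X ∣ {{ℕ.≢-nonZero ∣X∣≢0}}
          1≤b : 1ᴿ ≤ᴿ b
          1≤b = 1≤fromℕ ∣ Y ∣ {{ℕ.≢-nonZero ∣Y∣≢0}}
          1≤c : 1ᴿ ≤ᴿ N * s * s * b * (a * b)
          1≤c = 1≤x*y (1≤x*y (1≤x*y (1≤x*y (1≤fromℕ n) 1≤s) 1≤s) 1≤b) (1≤x*y 1≤a 1≤b)

      n⋆<⇒ν≪ : ∀ {r r′} → r ≃ᴿ r′ → n⋆ H order χ S {{∣S∣≢0}} <ᴿ r → ν ≪ r′
      n⋆<⇒ν≪ {r} {r′} = <ᴿ⇒≪ {n⋆ H order χ S {{∣S∣≢0}}} {ν} {r} {r′} (n⋆≃ H order χ S {{∣S∣≢0}})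

      edge : ∀ {r} → r * r ≃ᴿ a * b → ν ≪ r →
             ∃₂ λ x y → x ∈ X × y ∈ Y × Cay S x y
      edge r²≃ab ν≪r = cases (any? λ x → any? λ y →
        (from x ∈? X) ×-dec (from y ∈? Y) ×-dec (from y - from x ∈? S))
        where
        index∈ : ∀ (A : Subset n) i → lookup A i ≡ true → from i ∈ A
        index∈ A i i∈A = subst (Subset._∈ A) (sym (strictlyInverseˡ i)) (lookup⇒[]= i A i∈A)
        cases : Dec (∃₂ λ x y → from x ∈ X × from y ∈ Y × Cay S (from x) (from y)) →
                ∃₂ λ x y → x ∈ X × y ∈ Y × Cay S x y
        cases (yes (x , y , x∈X , y∈Y , xy∈S)) = from x , from y , x∈X , y∈Y , xy∈S
        cases (no no-edge) = contradiction
          (Σ-transform-triple S X Y λ s x y s∈S x∈X y∈Y y-x≈s → no-edge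
            (x , y , index∈ X x x∈X , index∈ Y y y∈Y ,
             subst (Subset._∈ S) (sym (trans (to-cong y-x≈s) (strictlyInverseˡ s))) (lookup⇒[]= s S s∈S)))
          (correlation-obstructs r²≃ab ν≪r)

theorem2p2 :
    ∀ {c ℓ} (H : AbelianGroup c ℓ) {m : ℕ} (order : HasOrder H (suc m)) →
    let open AbelianGroup H
        open Cayley H order
    in
    (S : Subset (suc m)) .{{_ : ℕ.NonZero ∣ S ∣}}
    (χ : Fin (suc m) → Character H) → Bijective _≡_ _≈ˣ_ χ → IsTrivial (χ zero) →
    (X Y : Subset (suc m)) →
    (n⋆ H order χ S <ᴿ √ (fromℕ (∣ X ∣ ℕ.* ∣ Y ∣)) →
      ∃₂ λ (x y : Carrier) → x ∈ X × y ∈ Y × Cay S x y)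
    ×
    (ε ∉ S → n⋆ H order χ S <ᴿ fromℕ ∣ X ∣ →
      ∃₂ λ (x y : Carrier) → x ∈ X × y ∈ X × x ≉ y × Cay S x y)
theorem2p2 H {m} order S χ (distinct , _) trivial X Y =
  (λ n⋆<√ → edge H order χ distinct trivial S X Y {sqrt (fromℕ (∣ X ∣ ℕ.* ∣ Y ∣))}
    (≃-trans (sqrt*sqrt (0≤fromℕ (∣ X ∣ ℕ.* ∣ Y ∣))) (fromℕ-* ∣ X ∣ ∣ Y ∣))
    (n⋆<⇒ν≪ H order χ distinct trivial S X Y {√ fromℕ (∣ X ∣ ℕ.* ∣ Y ∣)} {sqrt (fromℕ (∣ X ∣ ℕ.* ∣ Y ∣))}
      (√≃sqrt (fromℕ (∣ X ∣ ℕ.* ∣ Y ∣))) n⋆<√)) ,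
  -- With both vertex sets equal to `X`, the number |X| is itself the root of the product of the
  -- sizes, so no square root occurs.
  (λ ε∉S n⋆<∣X∣ → distinct-ends ε∉S (edge H order χ distinct trivial S X X {fromℕ ∣ X ∣} ≃-refl
    (n⋆<⇒ν≪ H order χ distinct trivial S X X {fromℕ ∣ X ∣} {fromℕ ∣ X ∣} ≃-refl n⋆<∣X∣)))
  where
  open AbelianGroup H
  open Inverse order using (to-cong)
  open Cayley H order
  -- An edge with equal ends is a loop, whose difference is `ε`.
  distinct-ends : ε ∉ S → (∃₂ λ x y → x ∈ X × y ∈ X × Cay S x y) →
                  ∃₂ λ x y → x ∈ X × y ∈ X × x ≉ y × Cay S x y
  distinct-ends ε∉S (x , y , x∈X , y∈X , y-x∈S) = x , y , x∈X , y∈X ,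
    (λ x≈y → ε∉S (subst (Subset._∈ S)
      (to-cong (GroupProperties.x≈y⇒x∙y⁻¹≈ε group (AbelianGroup.sym H x≈y))) y-x∈S)) , y-x∈S
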